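{- Let $p$ be a prime. (i) We have $$\sum_{k=0}^{p-1}\binom{(p-1)k}{k,\ldots,k}\equiv pB_{p-1}+(-1)^{p-1}-2p\pmod{p^2},$$ where the multinomial coefficient has $p-1$ lower entries equal to $k$. Also, an integer $m>1$ is a prime if and only if $$\sum_{k=0}^{m-1}\binom{(m-1)k}{k,\ldots,k}\equiv0\pmod m,$$ where the multinomial coefficient has $m-1$ lower entries equal to $k$. (ii) Let $n\in\mathbb{Z}^+$. If $n\not\equiv1\pmod p$ or there is a digit greater than $1$ in the representation of $n$ in base $p$, then $$\sum_{k=0}^{n-1}\binom{(p-1)k}{k,\ldots,k}\equiv0\pmod p;$$ otherwise we have $$\sum_{k=0}^{n-1}\binom{(p-1)k}{k,\ldots,k}\equiv(-1)^{\psi_p(n)-1}\pmod p,$$ where $\psi_p(n)$ denotes the sum of all the digits in the representation of $n$ in base $p$. (iii) The inequality $$\nu_p\left(\sum_{k=0}^{n-1}\binom{(p-1)k}{k,\ldots,k}\right)\geq\nu_p(n)$$ holds for all $n\in\mathbb{Z}^+$ if and only if the inequality $$\nu_p\left(\sum_{k=0}^{n-1}\binom{n-1}{k}(-1)^k\binom{(p-1)k}{k,\ldots,k}\right)\geq\nu_p(n)$$ holds for all $n\in\mathbb{Z}^+$.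
   Context: $\mathbb{Z}^+=\{1,2,3,\ldots\}$. The multinomial coefficient is $\binom{k_1+\cdots+k_h}{k_1,\ldots,k_h}=\frac{(k_1+\cdots+k_h)!}{k_1!\cdots k_h!}$; in particular, $\binom{hk}{k,\ldots,k}=\frac{(hk)!}{(k!)^h}$ with $h$ lower entries equal to $k$. $B_n$ denotes the $n$-th Bernoulli number, with $B_1=-1/2$. For a prime $p$ and integer $x$, $\nu_p(x)=\sup\{a\in\mathbb{Z}: p^a\mid x\}$ (so $\nu_p(0)=+\infty$), and $\nu_p(x/y)=\nu_p(x)-\nu_p(y)$ for $x\in\mathbb{Z}$, $y\in\mathbb{Z}^+$. For rational numbers $r,s$, $r\equiv s\pmod{p^2}$ means $\nu_p(r-s)\geq2$. -}

module Defs where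

open import Data.Digit using (toDigits)
open import Data.Fin.Base using (toℕ)
open import Data.Fin.Properties using (toℕ<n)
open import Data.Integer.Base as ℤ using (ℤ; +_; +0)
open import Data.Integer.Divisibility.Signed using (_∣_)
open import Data.List.Base using (List; filter; map; replicate; upTo)
open import Data.List.Extrema.Nat using (max)
open import Data.List.Relation.Unary.All using (universal)
open import Data.List.Relation.Unary.All.Properties using (map⁺)
open import Data.Nat.Base using (ℕ; zero; suc; _^_; _/_; _!; _<_; NonTrivial; nonTrivial⇒n>1)
open import Data.Nat.Combinatorics using (_C_)
open import Data.Nat.Divisibility using (_∣?_)
open import Data.Nat.Induction using (<-rec)
open import Data.Nat.ListAction using (sum; product)
open import Data.Nat.ListAction.Properties using (product≢0)
open import Data.Nat.Properties using (_!≢0)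
open import Data.Product.Base using (proj₁)
open import Data.Rational.Base as ℚ using (ℚ; 1ℚ)
open import Data.Rational.Properties using (+-0-commutativeMonoid)
open import Data.Rational.Literals using (fromℤ)
open import Algebra.Properties.CommutativeMonoid.Sum +-0-commutativeMonoid using (sum-syntax)
open import Relation.Binary.Construct.Add.Supremum.NonStrict ℤ._≤_ public using (_≤⁺_)
open import Relation.Nullary.Construct.Add.Supremum using (_⁺; [_]; ⊤⁺)
open import Relation.Nullary.Decidable using (fromWitness)

-- The divisor divides the factorial of the sum, so truncated division is exact.
multinomial : List ℕ → ℕ
multinomial ks = (sum ks ! / product (map _! ks)) {{product≢0 (map⁺ (universal _!≢0 ks))}}

uniformMultinomial : (h k : ℕ) → ℕ
uniformMultinomial h k = multinomial (replicate h k)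

-- B₀ = 1 and Σ_{k ≤ n} C(n+1, k) Bₖ = 0 for n ≥ 1, solved for Bₙ; hence B₁ = -1/2.
bernoulliStep : ∀ n → (∀ {k} → k < n → ℚ) → ℚ
bernoulliStep zero      B = 1ℚ
bernoulliStep n@(suc _) B =
  ℚ.- ((+ 1 ℚ./ suc n) ℚ.*
       (∑[ k < n ] (fromℤ (+ (suc n C toℕ k)) ℚ.* B (toℕ<n k))))

bernoulli : ℕ → ℚ
bernoulli = <-rec (λ _ → ℚ) bernoulliStep

-- For p ≥ 2 and n ≥ 1, p ^ a ∣ n forces a < p ^ a ≤ n, so the bound on a loses nothing.
maxExponent : (p n : ℕ) → ℕ
maxExponent p n = max 0 (filter (λ a → p ^ a ∣? n) (upTo (suc n)))

-- Meaningful for p ≥ 2.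
ν : ℕ → ℤ → ℤ ⁺
ν p +0 = ⊤⁺
ν p x  = [ + maxExponent p ℤ.∣ x ∣ ]

infixl 6 _⊖⁺_
_⊖⁺_ : ℤ ⁺ → ℕ → ℤ ⁺
[ a ] ⊖⁺ b = [ a ℤ.- + b ]
⊤⁺    ⊖⁺ b = ⊤⁺

-- ν_p(x/y) = ν_p(x) - ν_p(y), where y ≥ 1 has finite valuation.
νℚ : ℕ → ℚ → ℤ ⁺
νℚ p r = ν p (ℚ.↥ r) ⊖⁺ maxExponent p (ℚ.↧ₙ r)

infix 4 _≡_[mod_] _≡_[mod_²]

_≡_[mod_] : ℤ → ℤ → ℕ → Set
x ≡ y [mod m ] = + m ∣ x ℤ.- y

_≡_[mod_²] : ℚ → ℚ → ℕ → Set
r ≡ s [mod p ²] = [ + 2 ] ≤⁺ νℚ p (r ℚ.- s)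

-- Least significant digit first.
digits : (b n : ℕ) → .{{NonTrivial b}} → List ℕ
digits b n = map toℕ (proj₁ (toDigits b {fromWitness (nonTrivial⇒n>1 b)} n))

ψ : (b n : ℕ) → .{{NonTrivial b}} → ℕ
ψ b n = sum (digits b n)

{-# OPTIONS --safe #-}
-- Write a(k) for the multinomial coefficient with p - 1 lower entries k, S(n) for the sum of a(k)
-- over k < n, and factor a(k) as the product of the binomials C(jk, k), 1 ≤ j < p.
--
-- (ii) Lucas' theorem and Wilson's theorem give a(kp + r) ≡ w(r) a(k) mod p for 0 ≤ r < p, where
-- w = 1, -1, 0, 0, …. A full block of p consecutive terms therefore sums to 0, and
-- S(n'p + r) ≡ (w(0) + … + w(r - 1)) a(n'), with a(n') read off the digits of n'.
--
-- (i) If p ≥ 3, only k = 0, 1, 2 contribute modulo p², so S(p) ≡ 1 + (p - 1)! - p. With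
-- P(n) = 0ⁿ + … + (p - 1)ⁿ one has (p - 1)! ≡ P(p - 1) - p, and P(n) ≡ p B(n) for n < p because
-- both sides satisfy the same binomial recurrence up to p^(n+1); the loss of a factor p at
-- n = p - 1 is compensated by p ∣ C(p, k). For the primality test, j ∣ C(jk, k) for k ≥ 1, so a
-- proper divisor d of m divides every term but the first and the sum is 1 modulo d.
--
-- (iii) For an arbitrary integer sequence a, summation by parts turns the alternating sum into
-- Σ C(n, j) (-1)^(j-1) S(j) over 1 ≤ j ≤ n. As j C(n, j) = n C(n - 1, j - 1), a term is divisible
-- by n in the localisation at p as soon as S(j) is divisible by j, and the relation is triangular.
module Submission where

open import Defs
open import Data.Digit using (fromDigits; toDigits)
open import Data.Fin.Base using (Fin; toℕ)
open import Data.Fin.Properties using (toℕ<n)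
open import Data.Integer.Base as ℤ using (ℤ; +_; 0ℤ; 1ℤ; -1ℤ; _+_; _*_; _-_; -_; _^_)
import Data.Integer.Divisibility.Signed as ℤ∣
import Data.Integer.Properties as ℤ
open import Data.Integer.Properties using (+-0-commutativeMonoid)
open import Data.Integer.Tactic.RingSolver using (solve-∀)
open import Data.List.Base using (List; []; _∷_; filter; map; replicate; upTo)
open import Data.List.Extrema.Nat using (argmax-sel; xs≤max)
open import Data.List.Membership.Propositional.Properties using (∈-filter⁺; ∈-filter⁻; ∈-upTo⁺)
open import Data.List.Properties using (map-replicate)
import Data.List.Relation.Unary.All as All
open import Data.List.Relation.Unary.Any using (Any; here; there)
open import Data.Nat.Base as ℕ using (ℕ; zero; suc; z≤n; s≤s; _∸_; _<_; _≤_; _!; NonZero)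
open import Data.Nat.Combinatorics using (_C_; nC1≡n; nCn≡1; nCk≡nC[n∸k]; nCk+nC[k+1]≡[n+1]C[k+1]; nCk≡n!/k![n-k]!; k![n∸k]!∣n!; k>n⇒nCk≡0)
import Data.Nat.Coprimality as Coprimality
import Data.Nat.DivMod as ℕ
import Data.Nat.Divisibility as ℕ∣
open import Data.Nat.Divisibility using (_∣_; divides; hasNonTrivialDivisor)
open import Data.Nat.Induction using (<-rec; <-wellFounded)
import Data.Nat.ListAction as List
open import Data.Nat.Primality using (Prime; Composite; prime⇒nonTrivial; prime⇒nonZero; euclidsLemma; ¬composite⇒prime; ¬prime[0]; ¬prime[1])
import Data.Nat.Properties as ℕ
import Data.Nat.Tactic.RingSolver as ℕR
open import Data.Product.Base using (_×_; _,_; proj₂; ∃₂)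
open import Data.Rational.Base as ℚ using (ℚ; mkℚ; 0ℚ; 1ℚ)
open import Data.Rational.Literals using (fromℤ)
import Data.Rational.Properties as ℚ
open import Data.Rational.Unnormalised.Base using (mkℚᵘ; *≡*)
import Data.Rational.Unnormalised.Properties as ℚᵘ
open import Data.Sum.Base using (_⊎_; inj₁; inj₂; [_,_]′)
open import Function.Base using (_∘_)
open import Function.Bundles using (_⇔_; mk⇔)
open import Induction.WellFounded using (module FixPoint)
open import Level using (0ℓ)
open import Relation.Binary.Bundles using (Setoid)
open import Relation.Binary.Construct.Add.Supremum.NonStrict ℤ._≤_ using ([_]; _≤⊤⁺)
open import Relation.Binary.PropositionalEquality
import Relation.Binary.Reasoning.Setoid as SetoidReasoning
open import Relation.Nullary.Construct.Add.Supremum using ([_]; ⊤⁺)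
open import Relation.Nullary.Decidable using (fromWitness; dec⇒maybe)
open import Relation.Nullary.Negation.Core using (¬_; contradiction)
open import Tactic.RingSolver using () renaming (solve-∀ to solve-∀-in)
open import Tactic.RingSolver.Core.AlmostCommutativeRing using (AlmostCommutativeRing; fromCommutativeRing)
open import Algebra.Properties.CommutativeMonoid.Sum +-0-commutativeMonoid using (sum-syntax)
import Algebra.Properties.CommutativeMonoid.Sum ℚ.+-0-commutativeMonoid as ℚSum

-- Sums, binomial and uniform multinomial coefficients

∑< : ℕ → (ℕ → ℤ) → ℤ
∑< n f = ∑[ k < n ] f (toℕ k)

∑<-cong : ∀ n {f g : ℕ → ℤ} → (∀ k → f k ≡ g k) → ∑< n f ≡ ∑< n g
∑<-cong zero    f≗g = refl
∑<-cong (suc n) f≗g = cong₂ _+_ (f≗g 0) (∑<-cong n (f≗g ∘ suc))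

∑<-0 : ∀ n → ∑< n (λ _ → 0ℤ) ≡ 0ℤ
∑<-0 zero    = refl
∑<-0 (suc n) = trans (ℤ.+-identityˡ _) (∑<-0 n)

∑<-split : ∀ m n f → ∑< (m ℕ.+ n) f ≡ ∑< m f + ∑< n (f ∘ (m ℕ.+_))
∑<-split zero    n f = sym (ℤ.+-identityˡ _)
∑<-split (suc m) n f =
  trans (cong (_+_ (f 0)) (∑<-split m n (f ∘ suc))) (sym (ℤ.+-assoc (f 0) _ _))

∑<-last : ∀ n f → ∑< (suc n) f ≡ ∑< n f + f n
∑<-last zero    f = ℤ.+-comm (f 0) 0ℤ
∑<-last (suc n) f =
  trans (cong (_+_ (f 0)) (∑<-last n (f ∘ suc))) (sym (ℤ.+-assoc (f 0) _ _))

∑<-+ : ∀ n f g → ∑< n (λ k → f k + g k) ≡ ∑< n f + ∑< n g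
∑<-+ zero    f g = refl
∑<-+ (suc n) f g =
  trans (cong (_+_ (f 0 + g 0)) (∑<-+ n (f ∘ suc) (g ∘ suc))) (lemma (f 0) (g 0) _ _)
  where
  lemma : ∀ a b c d → a + b + (c + d) ≡ a + c + (b + d)
  lemma = solve-∀

∑<-* : ∀ n c f → ∑< n (λ k → c * f k) ≡ c * ∑< n f
∑<-* zero    c f = sym (ℤ.*-zeroʳ c)
∑<-* (suc n) c f =
  trans (cong (_+_ (c * f 0)) (∑<-* n c (f ∘ suc))) (sym (ℤ.*-distribˡ-+ c (f 0) _))

pascal : ∀ n k → suc n C suc k ≡ n C k ℕ.+ n C suc k
pascal n k = sym (nCk+nC[k+1]≡[n+1]C[k+1] n k)

-- Induction on the row: Pascal's rule splits the left side, the hypotheses apply at `k` and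
-- `suc k`, and Pascal's rule one row lower reassembles them.
absorption : ∀ n k → suc k ℕ.* (suc n C suc k) ≡ suc n ℕ.* (n C k)
absorption zero    zero    = refl
absorption zero    (suc k) = ℕ.*-zeroʳ (suc (suc k))
absorption (suc n) zero    =
  trans (ℕ.*-identityˡ _) (trans (nC1≡n (suc (suc n))) (sym (ℕ.*-identityʳ _)))
absorption (suc n) (suc k) = begin
  suc (suc k) ℕ.* (suc (suc n) C suc (suc k))
    ≡⟨ cong (suc (suc k) ℕ.*_) (pascal (suc n) (suc k)) ⟩
  suc (suc k) ℕ.* (x ℕ.+ (suc n C suc (suc k)))
    ≡⟨ ℕ.*-distribˡ-+ (suc (suc k)) x _ ⟩
  x ℕ.+ suc k ℕ.* x ℕ.+ suc (suc k) ℕ.* (suc n C suc (suc k))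
    ≡⟨ cong₂ (λ u v → x ℕ.+ u ℕ.+ v) (absorption n k) (absorption n (suc k)) ⟩
  x ℕ.+ suc n ℕ.* (n C k) ℕ.+ suc n ℕ.* (n C suc k)
    ≡⟨ lemma x (suc n) (n C k) (n C suc k) ⟩
  x ℕ.+ suc n ℕ.* (n C k ℕ.+ n C suc k)
    ≡⟨ cong (λ y → x ℕ.+ suc n ℕ.* y) (pascal n k) ⟨
  suc (suc n) ℕ.* (suc n C suc k) ∎
  where
  open ≡-Reasoning
  x = suc n C suc k
  lemma : ∀ x n a b → x ℕ.+ n ℕ.* a ℕ.+ n ℕ.* b ≡ x ℕ.+ n ℕ.* (a ℕ.+ b)
  lemma = ℕR.solve-∀

C-factorial : ∀ m n → ((m ℕ.+ n) C m) ℕ.* (m ! ℕ.* n !) ≡ (m ℕ.+ n) !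
C-factorial m n = begin
  ((m ℕ.+ n) C m) ℕ.* (m ! ℕ.* n !)
    ≡⟨ cong (λ x → ((m ℕ.+ n) C m) ℕ.* (m ! ℕ.* x !)) (ℕ.m+n∸m≡n m n) ⟨
  ((m ℕ.+ n) C m) ℕ.* d
    ≡⟨ cong (ℕ._* d) (nCk≡n!/k![n-k]! m≤m+n) ⟩
  (m ℕ.+ n) ! ℕ./ d ℕ.* d
    ≡⟨ ℕ.m/n*n≡m (k![n∸k]!∣n! m≤m+n) ⟩
  (m ℕ.+ n) ! ∎
  where
  open ≡-Reasoning
  m≤m+n = ℕ.m≤m+n m n
  d = m ! ℕ.* (m ℕ.+ n ∸ m) !
  instance _ = m ℕ.!* (m ℕ.+ n ∸ m) !≢0

private
  sum-replicate : ∀ h k → List.sum (replicate h k) ≡ h ℕ.* k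
  sum-replicate zero    k = refl
  sum-replicate (suc h) k = cong (k ℕ.+_) (sum-replicate h k)

  product-replicate : ∀ h k → List.product (replicate h k) ≡ k ℕ.^ h
  product-replicate zero    k = refl
  product-replicate (suc h) k = cong (k ℕ.*_) (product-replicate h k)

  -- Each further factor `k !` is absorbed by a binomial: C(k + hk, k) · k! · (hk)! = (k + hk)!.
  k!^h∣[h*k]! : ∀ h k → (k !) ℕ.^ h ∣ (h ℕ.* k) !
  k!^h∣[h*k]! zero    k = ℕ∣.∣-refl
  k!^h∣[h*k]! (suc h) k = ℕ∣.∣-trans (ℕ∣.*-monoʳ-∣ (k !) (k!^h∣[h*k]! h k))
    (divides ((k ℕ.+ h ℕ.* k) C k) (sym (C-factorial k (h ℕ.* k))))

-- This makes the truncated division of the definition exact; the identities below are read off from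
-- this equation by cancellation.
uniformMultinomial-factorial : ∀ h k → uniformMultinomial h k ℕ.* (k !) ℕ.^ h ≡ (h ℕ.* k) !
uniformMultinomial-factorial h k =
  trans (cong (uniformMultinomial h k ℕ.*_) (sym product≡))
    (trans (ℕ.m/n*n≡m {{_}} (subst₂ _∣_ (sym product≡) (cong _! (sym (sum-replicate h k))) (k!^h∣[h*k]! h k)))
      (cong _! (sum-replicate h k)))
  where
  product≡ : List.product (map _! (replicate h k)) ≡ (k !) ℕ.^ h
  product≡ = trans (cong List.product (map-replicate _! h k)) (product-replicate h (k !))

-- Iterated, this gives the product of the binomials C(jk, k), the form on which divisibility and
-- Lucas' theorem act.
uniformMultinomial-suc : ∀ h k →
  uniformMultinomial (suc h) k ≡ ((suc h ℕ.* k) C k) ℕ.* uniformMultinomial h k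
uniformMultinomial-suc h k = ℕ.*-cancelʳ-≡ _ _ _ (begin
  uniformMultinomial (suc h) k ℕ.* (k !) ℕ.^ suc h
    ≡⟨ uniformMultinomial-factorial (suc h) k ⟩
  (k ℕ.+ h ℕ.* k) !
    ≡⟨ C-factorial k (h ℕ.* k) ⟨
  c ℕ.* (k ! ℕ.* (h ℕ.* k) !)
    ≡⟨ cong (λ x → c ℕ.* (k ! ℕ.* x)) (uniformMultinomial-factorial h k) ⟨
  c ℕ.* (k ! ℕ.* (uniformMultinomial h k ℕ.* (k !) ℕ.^ h))
    ≡⟨ lemma c (k !) _ _ ⟩
  c ℕ.* uniformMultinomial h k ℕ.* (k !) ℕ.^ suc h ∎)
  where
  open ≡-Reasoning
  c = (suc h ℕ.* k) C k
  instance
    _ = k ℕ.!≢0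
    _ = ℕ.m^n≢0 (k !) (suc h)
  lemma : ∀ a b c d → a ℕ.* (b ℕ.* (c ℕ.* d)) ≡ a ℕ.* c ℕ.* (b ℕ.* d)
  lemma = ℕR.solve-∀

uniformMultinomial-zero : ∀ h → uniformMultinomial h 0 ≡ 1
uniformMultinomial-zero h = begin
  uniformMultinomial h 0                ≡⟨ ℕ.*-identityʳ _ ⟨
  uniformMultinomial h 0 ℕ.* 1          ≡⟨ cong (uniformMultinomial h 0 ℕ.*_) (ℕ.^-zeroˡ h) ⟨
  uniformMultinomial h 0 ℕ.* (0 !) ℕ.^ h ≡⟨ uniformMultinomial-factorial h 0 ⟩
  (h ℕ.* 0) !                           ≡⟨ cong _! (ℕ.*-zeroʳ h) ⟩
  1 ∎
  where open ≡-Reasoning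

uniformMultinomial-one : ∀ h → uniformMultinomial h 1 ≡ h !
uniformMultinomial-one h = begin
  uniformMultinomial h 1                ≡⟨ ℕ.*-identityʳ _ ⟨
  uniformMultinomial h 1 ℕ.* 1          ≡⟨ cong (uniformMultinomial h 1 ℕ.*_) (ℕ.^-zeroˡ h) ⟨
  uniformMultinomial h 1 ℕ.* (1 !) ℕ.^ h ≡⟨ uniformMultinomial-factorial h 1 ⟩
  (h ℕ.* 1) !                           ≡⟨ cong _! (ℕ.*-identityʳ h) ⟩
  h ! ∎
  where open ≡-Reasoning

∣C⇒∣uniformMultinomial : ∀ {d} h j k → j < h → d ∣ (suc j ℕ.* k) C k → d ∣ uniformMultinomial h k
∣C⇒∣uniformMultinomial {d} (suc h) j k j<1+h d∣C
  rewrite uniformMultinomial-suc h k with ℕ.m≤n⇒m<n∨m≡n (ℕ.≤-pred j<1+h)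
... | inj₁ j<h  = ℕ∣.∣n⇒∣m*n ((suc h ℕ.* k) C k) (∣C⇒∣uniformMultinomial h j k j<h d∣C)
... | inj₂ refl = ℕ∣.∣m⇒∣m*n (uniformMultinomial h k) d∣C

-- For j, k ≥ 1, absorption gives k C(jk, k) = jk C(jk - 1, k - 1), and cancelling k leaves the
-- factor j. At k = 0 the binomial is 1, hence the `suc k`.
j∣[j*k]Ck : ∀ j k → suc j ∣ (suc j ℕ.* suc k) C suc k
j∣[j*k]Ck j k = divides (n C k) (ℕ.*-cancelˡ-≡ _ _ (suc k) (begin
  suc k ℕ.* (suc n C suc k)   ≡⟨ absorption n k ⟩
  suc n ℕ.* (n C k)           ≡⟨ lemma (suc j) (suc k) (n C k) ⟩
  suc k ℕ.* ((n C k) ℕ.* suc j) ∎))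
  where
  open ≡-Reasoning
  n = k ℕ.+ j ℕ.* suc k
  lemma : ∀ a b c → a ℕ.* b ℕ.* c ≡ b ℕ.* (c ℕ.* a)
  lemma = ℕR.solve-∀

≤⇒∣uniformMultinomial : ∀ {d h} k → NonZero d → d ≤ h → d ∣ uniformMultinomial h (suc k)
≤⇒∣uniformMultinomial {suc j} k _ d≤h = ∣C⇒∣uniformMultinomial _ j (suc k) d≤h (j∣[j*k]Ck j k)

-- Congruences and power sums

-- Being a record, this lets Agda infer x and y, which the relation of Defs does not.
record Cong (m : ℕ) (x y : ℤ) : Set where
  constructor congruent
  field difference : x ≡ y [mod m ]


module _ {m : ℕ} where

  Cong-reflexive : ∀ {x y} → x ≡ y → Cong m x y
  Cong-reflexive {x} refl = congruent (ℤ∣.divides 0ℤ (ℤ.+-inverseʳ x))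

  Cong-refl : ∀ {x} → Cong m x x
  Cong-refl = Cong-reflexive refl

  Cong-sym : ∀ {x y} → Cong m x y → Cong m y x
  Cong-sym {x} {y} (congruent d) = congruent (subst (+ m ℤ∣.∣_) (lemma x y) (ℤ∣.∣m⇒∣-m d))
    where
    lemma : ∀ x y → - (x - y) ≡ y - x
    lemma = solve-∀

  Cong-trans : ∀ {x y z} → Cong m x y → Cong m y z → Cong m x z
  Cong-trans {x} {y} {z} (congruent d) (congruent e) =
    congruent (subst (+ m ℤ∣.∣_) (lemma x y z) (ℤ∣.∣m∣n⇒∣m+n d e))
    where
    lemma : ∀ x y z → x - y + (y - z) ≡ x - z
    lemma = solve-∀

  +-mono-Cong : ∀ {x y u v} → Cong m x y → Cong m u v → Cong m (x + u) (y + v)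
  +-mono-Cong {x} {y} {u} {v} (congruent d) (congruent e) =
    congruent (subst (+ m ℤ∣.∣_) (lemma x y u v) (ℤ∣.∣m∣n⇒∣m+n d e))
    where
    lemma : ∀ x y u v → x - y + (u - v) ≡ x + u - (y + v)
    lemma = solve-∀

  *-mono-Cong : ∀ {x y u v} → Cong m x y → Cong m u v → Cong m (x * u) (y * v)
  *-mono-Cong {x} {y} {u} {v} (congruent d) (congruent e) =
    congruent (subst (+ m ℤ∣.∣_) (lemma x y u v)
      (ℤ∣.∣m∣n⇒∣m+n (ℤ∣.∣n⇒∣m*n u d) (ℤ∣.∣n⇒∣m*n y e)))
    where
    lemma : ∀ x y u v → u * (x - y) + y * (u - v) ≡ x * u - y * v
    lemma = solve-∀

  *-monoʳ-Cong : ∀ x {u v} → Cong m u v → Cong m (x * u) (x * v)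
  *-monoʳ-Cong x = *-mono-Cong (Cong-refl {x})

  ^-mono-Cong : ∀ n {x y} → Cong m x y → Cong m (x ^ n) (y ^ n)
  ^-mono-Cong zero    x≈y = Cong-refl
  ^-mono-Cong (suc n) x≈y = *-mono-Cong x≈y (^-mono-Cong n x≈y)

  neg-mono-Cong : ∀ {x y} → Cong m x y → Cong m (- x) (- y)
  neg-mono-Cong {x} {y} (congruent d) = congruent (subst (+ m ℤ∣.∣_) (lemma x y) (ℤ∣.∣m⇒∣-m d))
    where
    lemma : ∀ x y → - (x - y) ≡ - x - (- y)
    lemma = solve-∀

  +-monoˡ-Cong : ∀ x {u v} → Cong m u v → Cong m (u + x) (v + x)
  +-monoˡ-Cong x u≈v = +-mono-Cong u≈v (Cong-refl {x})

  ∣⇒Cong-0 : ∀ {x} → + m ℤ∣.∣ x → Cong m x 0ℤ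
  ∣⇒Cong-0 {x} d = congruent (subst (+ m ℤ∣.∣_) (sym (ℤ.+-identityʳ x)) d)

  Cong-0⇒∣ : ∀ {x} → Cong m x 0ℤ → + m ℤ∣.∣ x
  Cong-0⇒∣ {x} (congruent d) = subst (+ m ℤ∣.∣_) (ℤ.+-identityʳ x) d

  ∣ℕ⇒Cong-0 : ∀ {n} → m ∣ n → Cong m (+ n) 0ℤ
  ∣ℕ⇒Cong-0 m∣n = ∣⇒Cong-0 (ℤ∣.∣ᵤ⇒∣ m∣n)

  Cong-0⇒∣ℕ : ∀ {n} → Cong m (+ n) 0ℤ → m ∣ n
  Cong-0⇒∣ℕ c = ℤ∣.∣⇒∣ᵤ (Cong-0⇒∣ c)

  ∑<-mono-Cong : ∀ n {f g} → (∀ k → k < n → Cong m (f k) (g k)) → Cong m (∑< n f) (∑< n g)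
  ∑<-mono-Cong zero    f≈g = Cong-refl
  ∑<-mono-Cong (suc n) f≈g =
    +-mono-Cong (f≈g 0 (s≤s z≤n)) (∑<-mono-Cong n (λ k k<n → f≈g (suc k) (s≤s k<n)))

  ∑<-Cong-0 : ∀ n {f} → (∀ k → k < n → Cong m (f k) 0ℤ) → Cong m (∑< n f) 0ℤ
  ∑<-Cong-0 n f≈0 = Cong-trans (∑<-mono-Cong n f≈0) (Cong-reflexive (∑<-0 n))

Cong-setoid : ℕ → Setoid 0ℓ 0ℓ
Cong-setoid m = record
  { _≈_ = Cong m
  ; isEquivalence = record { refl = Cong-refl ; sym = Cong-sym ; trans = Cong-trans }
  }

*-mono-Cong-0 : ∀ {m n x y} → Cong m x 0ℤ → Cong n y 0ℤ → Cong (m ℕ.* n) (x * y) 0ℤ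
*-mono-Cong-0 {m} {n} {x} {y} x≈0 y≈0 with Cong-0⇒∣ x≈0 | Cong-0⇒∣ y≈0
... | ℤ∣.divides q refl | ℤ∣.divides r refl = ∣⇒Cong-0 (ℤ∣.divides (q * r)
  (trans (lemma q (+ m) r (+ n)) (cong (q * r *_) (sym (ℤ.pos-* m n)))))
  where
  lemma : ∀ q m r n → q * m * (r * n) ≡ q * r * (m * n)
  lemma = solve-∀

pos-^ : ∀ m n → + (m ℕ.^ n) ≡ (+ m) ^ n
pos-^ m zero    = refl
pos-^ m (suc n) = trans (ℤ.pos-* m (m ℕ.^ n)) (cong (+ m *_) (pos-^ m n))

^-distribʳ-* : ∀ n x y → (x * y) ^ n ≡ x ^ n * y ^ n
^-distribʳ-* zero    x y = refl
^-distribʳ-* (suc n) x y = trans (cong (x * y *_) (^-distribʳ-* n x y)) (lemma x y (x ^ n) (y ^ n))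
  where
  lemma : ∀ x y u v → x * y * (u * v) ≡ x * u * (y * v)
  lemma = solve-∀

-1^n≡±1 : ∀ n → -1ℤ ^ n ≡ 1ℤ ⊎ -1ℤ ^ n ≡ -1ℤ
-1^n≡±1 zero    = inj₁ refl
-1^n≡±1 (suc n) with -1^n≡±1 n
... | inj₁ eq = inj₂ (cong (-1ℤ *_) eq)
... | inj₂ eq = inj₁ (cong (-1ℤ *_) eq)

pos-C-pascal : ∀ n k → + (suc n C suc k) ≡ + (n C k) + + (n C suc k)
pos-C-pascal n k = trans (cong +_ (pascal n k)) (ℤ.pos-+ (n C k) (n C suc k))

-- The limit `N` is free above `n` because Pascal's rule produces row `n` twice, once with `N` terms
-- and once with `suc N`.
binomial : ∀ {n N} x → n < N → ∑< N (λ k → + (n C k) * x ^ k) ≡ (1ℤ + x) ^ n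
binomial {zero}  {suc N} x _ = trans (cong (_+_ 1ℤ) (∑<-0 N)) (ℤ.+-identityʳ 1ℤ)
binomial {suc n} {suc N} x (s≤s n<N) = begin
  1ℤ * 1ℤ + ∑< N (λ k → + (suc n C suc k) * x ^ suc k)
    ≡⟨ cong (_+_ (1ℤ * 1ℤ)) (∑<-cong N λ k →
         trans (cong (_* x ^ suc k) (pos-C-pascal n k)) (lemma₁ (+ (n C k)) (+ (n C suc k)) x (x ^ k))) ⟩
  1ℤ * 1ℤ + ∑< N (λ k → x * (+ (n C k) * x ^ k) + + (n C suc k) * x ^ suc k)
    ≡⟨ cong (_+_ (1ℤ * 1ℤ)) (∑<-+ N (λ k → x * (+ (n C k) * x ^ k)) (λ k → + (n C suc k) * x ^ suc k)) ⟩
  1ℤ * 1ℤ + (∑< N (λ k → x * (+ (n C k) * x ^ k)) + ∑< N (λ k → + (n C suc k) * x ^ suc k))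
    ≡⟨ lemma₂ (∑< N (λ k → x * (+ (n C k) * x ^ k))) _ ⟩
  ∑< N (λ k → x * (+ (n C k) * x ^ k)) + ∑< (suc N) (λ k → + (n C k) * x ^ k)
    ≡⟨ cong₂ _+_ (trans (∑<-* N x (λ k → + (n C k) * x ^ k)) (cong (x *_) (binomial x n<N)))
         (binomial x (ℕ.m<n⇒m<1+n n<N)) ⟩
  x * (1ℤ + x) ^ n + (1ℤ + x) ^ n
    ≡⟨ lemma₃ x ((1ℤ + x) ^ n) ⟩
  (1ℤ + x) ^ suc n ∎
  where
  open ≡-Reasoning
  lemma₁ : ∀ a b x y → (a + b) * (x * y) ≡ x * (a * y) + b * (x * y)
  lemma₁ = solve-∀
  lemma₂ : ∀ a b → 1ℤ * 1ℤ + (a + b) ≡ a + (1ℤ * 1ℤ + b)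
  lemma₂ = solve-∀
  lemma₃ : ∀ x y → x * y + y ≡ (1ℤ + x) * y
  lemma₃ = solve-∀

powerSum : ℕ → ℕ → ℤ
powerSum N k = ∑< N (λ j → (+ j) ^ k)

-- The term j = 0 counts as 0⁰ = 1, so nothing is lost at the start of the range.
powerSum-0 : ∀ N → powerSum N 0 ≡ + N
powerSum-0 zero    = refl
powerSum-0 (suc N) = cong (_+_ 1ℤ) (powerSum-0 N)

-- Telescoping: by the binomial theorem (j + 1)^(n+1) - j^(n+1) is the sum of C(n + 1, k) j^k over k
-- ≤ n; summing over j < N gives N^(n+1).
powerSum-recurrence : ∀ n N → ∑< (suc n) (λ k → + (suc n C k) * powerSum N k) ≡ (+ N) ^ suc n
powerSum-recurrence n zero    = trans (∑<-cong (suc n) λ k → ℤ.*-zeroʳ (+ (suc n C k))) (∑<-0 (suc n))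
powerSum-recurrence n (suc N) = begin
  ∑< (suc n) (λ k → + (suc n C k) * powerSum (suc N) k)
    ≡⟨ ∑<-cong (suc n) (λ k → trans (cong (+ (suc n C k) *_) (∑<-last N (λ j → (+ j) ^ k)))
         (ℤ.*-distribˡ-+ (+ (suc n C k)) (powerSum N k) _)) ⟩
  ∑< (suc n) (λ k → + (suc n C k) * powerSum N k + + (suc n C k) * (+ N) ^ k)
    ≡⟨ ∑<-+ (suc n) (λ k → + (suc n C k) * powerSum N k) (λ k → + (suc n C k) * (+ N) ^ k) ⟩
  ∑< (suc n) (λ k → + (suc n C k) * powerSum N k) + ∑< (suc n) (λ k → + (suc n C k) * (+ N) ^ k)
    ≡⟨ cong (_+ s) (powerSum-recurrence n N) ⟩
  (+ N) ^ suc n + s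
    ≡⟨ ℤ.+-comm _ s ⟩
  s + (+ N) ^ suc n
    ≡⟨ cong (_+_ s) (trans (cong (λ c → + c * (+ N) ^ suc n) (nCn≡1 (suc n))) (ℤ.*-identityˡ _)) ⟨
  s + + (suc n C suc n) * (+ N) ^ suc n
    ≡⟨ ∑<-last (suc n) (λ k → + (suc n C k) * (+ N) ^ k) ⟨
  ∑< (suc (suc n)) (λ k → + (suc n C k) * (+ N) ^ k)
    ≡⟨ binomial {suc n} (+ N) ℕ.≤-refl ⟩
  (+ suc N) ^ suc n ∎
  where
  open ≡-Reasoning
  s = ∑< (suc n) (λ k → + (suc n C k) * (+ N) ^ k)

-- Divisibility by a prime

module _ {p : ℕ} (pr : Prime p) where

  private instance
    nonTrivial = prime⇒nonTrivial pr
    nonZero    = prime⇒nonZero pr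

  ∤1 : ¬ p ∣ 1
  ∤1 p∣1 = ℕ.nonTrivial⇒≢1 {p} (ℕ∣.∣1⇒≡1 p∣1)

  ∤-* : ∀ {m n} → ¬ p ∣ m → ¬ p ∣ n → ¬ p ∣ m ℕ.* n
  ∤-* {m} {n} p∤m p∤n p∣mn = [ p∤m , p∤n ]′ (euclidsLemma m n pr p∣mn)

  ∤-^ : ∀ {n} e → ¬ p ∣ n → ¬ p ∣ n ℕ.^ e
  ∤-^ zero    p∤n = ∤1
  ∤-^ (suc e) p∤n = ∤-* p∤n (∤-^ e p∤n)

  ∤-! : ∀ {n} → n < p → ¬ p ∣ n !
  ∤-! {zero}  n<p = ∤1
  ∤-! {suc n} n<p = ∤-* (ℕ∣.>⇒∤ n<p) (∤-! (ℕ.<-trans (ℕ.n<1+n n) n<p))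

  -- By absorption `p` divides k C(p, k), and it does not divide k. The helper `go` names the row
  -- `n` so that it can be matched as a successor.
  p∣C : ∀ k → 0 < k → k < p → p ∣ (p C k)
  p∣C (suc k) _ k<p = go p refl k<p
    where
    go : ∀ n → p ≡ n → suc k < n → p ∣ n C suc k
    go (suc n) p≡ k<n with euclidsLemma (suc k) (suc n C suc k) pr
                             (subst (p ∣_) (sym (absorption n k)) (ℕ∣.∣m⇒∣m*n (n C k) (ℕ∣.∣-reflexive p≡)))
    ... | inj₁ p∣k = contradiction p∣k (ℕ∣.>⇒∤ (subst (suc k <_) (sym p≡) k<n))
    ... | inj₂ p∣C = p∣C

  -- Euclid's lemma places one factor `p` in `m`; it is cancelled on both sides and the induction
  -- continues with the cofactor.
  p^e∣m*n⇒p^e∣m : ∀ e {m n} → ¬ p ∣ n → p ℕ.^ e ∣ m ℕ.* n → p ℕ.^ e ∣ m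
  p^e∣m*n⇒p^e∣m zero {m} p∤n _ = ℕ∣.1∣ m
  p^e∣m*n⇒p^e∣m (suc e) {m} {n} p∤n p^e∣mn
    with euclidsLemma m n pr (ℕ∣.∣-trans (ℕ∣.m∣m*n (p ℕ.^ e)) p^e∣mn)
  ... | inj₂ p∣n = contradiction p∣n p∤n
  ... | inj₁ (divides q refl) = subst (p ℕ.^ suc e ∣_) (ℕ.*-comm p q)
    (ℕ∣.*-monoʳ-∣ p (p^e∣m*n⇒p^e∣m e p∤n
      (ℕ∣.*-cancelˡ-∣ p (subst (p ℕ.* p ℕ.^ e ∣_) (lemma q p n) p^e∣mn))))
    where
    lemma : ∀ q p n → q ℕ.* p ℕ.* n ≡ p ℕ.* (q ℕ.* n)
    lemma = ℕR.solve-∀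

  *-cancel-Cong-0 : ∀ {x n} e → ¬ p ∣ n → Cong (p ℕ.^ e) (x * + n) 0ℤ → Cong (p ℕ.^ e) x 0ℤ
  *-cancel-Cong-0 {x} {n} e p∤n c = ∣⇒Cong-0 (ℤ∣.∣ᵤ⇒∣ (p^e∣m*n⇒p^e∣m e p∤n
    (subst (p ℕ.^ e ∣_) (ℤ.abs-* x (+ n)) (ℤ∣.∣⇒∣ᵤ (Cong-0⇒∣ c)))))

  -- The power sum recurrence expresses x^p through the C(p, k) with k < p. All of these but k = 0
  -- are divisible by `p`, and the remaining term is `powerSum x 0`, that is `x`.
  fermat : ∀ x → Cong p ((+ x) ^ p) (+ x)
  fermat x = go p refl
    where
    go : ∀ n → p ≡ n → Cong p ((+ x) ^ n) (+ x)
    go zero    p≡0 = contradiction p≡0 (ℕ.≢-nonZero⁻¹ p)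
    go (suc h) p≡  = begin
      (+ x) ^ suc h
        ≡⟨ powerSum-recurrence h x ⟨
      1ℤ * powerSum x 0 + ∑< h (λ k → + (suc h C suc k) * powerSum x (suc k))
        ≈⟨ +-mono-Cong (Cong-reflexive (trans (ℤ.*-identityˡ _) (powerSum-0 x)))
             (∑<-Cong-0 h λ k k<h → *-mono-Cong {u = powerSum x (suc k)}
               (∣ℕ⇒Cong-0 (subst (λ n → p ∣ n C suc k) p≡
                 (p∣C (suc k) (s≤s z≤n) (subst (suc k <_) (sym p≡) (s≤s k<h))))) Cong-refl) ⟩
      + x + 0ℤ
        ≡⟨ ℤ.+-identityʳ (+ x) ⟩
      + x ∎
      where open SetoidReasoning (Cong-setoid p)

-- Theorems of Fermat, Wilson and Lucas

-- The `n`-th forward difference of `f` at `x`.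
diff : ℕ → (ℕ → ℤ) → ℕ → ℤ
diff zero    f x = f x
diff (suc n) f x = diff n f (suc x) - diff n f x

-- The Leibniz rule for differences with the identity function as one factor: its second and higher
-- differences vanish, so two terms remain.
diff-leibniz : ∀ n g x →
  diff (suc n) (λ x → + x * g x) x ≡ + x * diff (suc n) g x + + suc n * diff n g (suc x)
diff-leibniz zero    g x = trans (cong (λ y → y * g (suc x) - + x * g x) (ℤ.pos-+ 1 x)) (lemma (+ x) (g (suc x)) (g x))
  where
  lemma : ∀ x a b → (1ℤ + x) * a - x * b ≡ x * (a - b) + 1ℤ * a
  lemma = solve-∀
diff-leibniz (suc n) g x = begin
  diff (suc n) (λ x → + x * g x) (suc x) - diff (suc n) (λ x → + x * g x) x
    ≡⟨ cong₂ _-_ (diff-leibniz n g (suc x)) (diff-leibniz n g x) ⟩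
  + suc x * diff (suc n) g (suc x) + + suc n * b - (+ x * diff (suc n) g x + + suc n * a)
    ≡⟨ lemma (+ x) (+ suc n) (diff (suc n) g x) a b ⟩
  + x * diff (suc (suc n)) g x + + suc (suc n) * diff (suc n) g (suc x) ∎
  where
  open ≡-Reasoning
  a = diff n g (suc x)
  b = diff n g (suc (suc x))
  lemma : ∀ x n d a b →
    (1ℤ + x) * (b - a) + n * b - (x * d + n * a) ≡ x * (b - a - d) + (1ℤ + n) * (b - a)
  lemma = solve-∀

-- By induction the `n`-th difference of the `n`-th power is constant, so the first Leibniz term
-- vanishes and the second contributes the factor `suc n`.
diff-pow : ∀ n x → diff n (λ x → (+ x) ^ n) x ≡ + (n !)
diff-pow zero    x = refl
diff-pow (suc n) x = begin
  diff (suc n) (λ x → (+ x) ^ suc n) x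
    ≡⟨ diff-leibniz n (λ x → (+ x) ^ n) x ⟩
  + x * (diff n (λ x → (+ x) ^ n) (suc x) - diff n (λ x → (+ x) ^ n) x) + + suc n * diff n (λ x → (+ x) ^ n) (suc x)
    ≡⟨ cong₂ (λ u v → + x * (u - v) + + suc n * u) (diff-pow n (suc x)) (diff-pow n x) ⟩
  + x * (+ (n !) - + (n !)) + + suc n * + (n !)
    ≡⟨ lemma (+ x) (+ (n !)) (+ suc n) ⟩
  + suc n * + (n !)
    ≡⟨ ℤ.pos-* (suc n) (n !) ⟨
  + (suc n !) ∎
  where
  open ≡-Reasoning
  lemma : ∀ x a n → x * (a - a) + n * a ≡ n * a
  lemma = solve-∀

module _ {p : ℕ} (pr : Prime p) where

  private instance
    nonTrivial = prime⇒nonTrivial pr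
    nonZero    = prime⇒nonZero pr

  open SetoidReasoning (Cong-setoid p)

  1<p : 1 < p
  1<p = ℕ.nonTrivial⇒n>1 p

  fermat′ : ∀ {x} → ¬ p ∣ x → Cong p ((+ x) ^ (p ∸ 1)) 1ℤ
  fermat′ {x} p∤x = begin
    (+ x) ^ (p ∸ 1)             ≡⟨ lemma₁ ((+ x) ^ (p ∸ 1)) ⟨
    (+ x) ^ (p ∸ 1) - 1ℤ + 1ℤ   ≈⟨ +-monoˡ-Cong 1ℤ x^h-1≈0 ⟩
    0ℤ + 1ℤ                     ≡⟨⟩
    1ℤ                          ∎
    where
    lemma₁ : ∀ y → y - 1ℤ + 1ℤ ≡ y
    lemma₁ = solve-∀
    lemma₂ : ∀ x y → (y - 1ℤ) * x ≡ x * y - x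
    lemma₂ = solve-∀
    x^p-x≈0 : Cong p (((+ x) ^ (p ∸ 1) - 1ℤ) * + x) 0ℤ
    x^p-x≈0 = begin
      ((+ x) ^ (p ∸ 1) - 1ℤ) * + x ≡⟨ lemma₂ (+ x) ((+ x) ^ (p ∸ 1)) ⟩
      (+ x) ^ suc (p ∸ 1) - + x    ≡⟨ cong (λ n → (+ x) ^ n - + x) (ℕ.suc-pred p) ⟩
      (+ x) ^ p - + x              ≈⟨ +-monoˡ-Cong (- (+ x)) (fermat pr x) ⟩
      + x - + x                    ≡⟨ ℤ.+-inverseʳ (+ x) ⟩
      0ℤ                           ∎
    x^h-1≈0 : Cong p ((+ x) ^ (p ∸ 1) - 1ℤ) 0ℤ
    x^h-1≈0 = subst (λ m → Cong m ((+ x) ^ (p ∸ 1) - 1ℤ) 0ℤ) (ℕ.*-identityʳ p)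
      (*-cancel-Cong-0 pr 1 p∤x (subst (λ m → Cong m (((+ x) ^ (p ∸ 1) - 1ℤ) * + x) 0ℤ)
        (sym (ℕ.*-identityʳ p)) x^p-x≈0))

  -- Fermat's theorem at p - 1 ≡ -1 avoids a case distinction on the parity of `p`.
  -1^p : Cong p (-1ℤ ^ p) -1ℤ
  -1^p = begin
    -1ℤ ^ p             ≈⟨ ^-mono-Cong p p-1≈-1 ⟨
    (+ (p ∸ 1)) ^ p     ≈⟨ fermat pr (p ∸ 1) ⟩
    + (p ∸ 1)           ≈⟨ p-1≈-1 ⟩
    -1ℤ                 ∎
    where
    lemma : ∀ x → x ≡ 1ℤ + x + -1ℤ
    lemma = solve-∀
    p-1≈-1 : Cong p (+ (p ∸ 1)) -1ℤ
    p-1≈-1 = begin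
      + (p ∸ 1)               ≡⟨ lemma (+ (p ∸ 1)) ⟩
      + suc (p ∸ 1) + -1ℤ     ≡⟨ cong (λ n → + n + -1ℤ) (ℕ.suc-pred p) ⟩
      + p + -1ℤ               ≈⟨ +-monoˡ-Cong -1ℤ (∣ℕ⇒Cong-0 ℕ∣.∣-refl) ⟩
      -1ℤ                     ∎

  -- (p - 1)! is the difference of order p - 1 of x^(p-1) at 0. Modulo `p` this function is 0 at 0
  -- and 1 at 1, ..., p - 1, so its differences at positive points vanish and those at 0 alternate
  -- in sign.
  wilson : Cong p (+ ((p ∸ 1) !)) -1ℤ
  wilson = go p refl 1<p
    where
    f : ℕ → ℤ
    f x = (+ x) ^ (p ∸ 1)

    f≈1 : ∀ x → suc x < p → Cong p (f (suc x)) 1ℤ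
    f≈1 x x<p = fermat′ (ℕ∣.>⇒∤ x<p)

    diff-f-suc : ∀ n x → suc x ℕ.+ suc n < p → Cong p (diff (suc n) f (suc x)) 0ℤ
    diff-f-suc zero x x+1<p = +-mono-Cong (f≈1 (suc x) (subst (_< p) (cong suc (ℕ.+-comm x 1)) x+1<p))
      (neg-mono-Cong (f≈1 x (ℕ.≤-<-trans (ℕ.m≤m+n (suc x) 1) x+1<p)))
    diff-f-suc (suc n) x x+n<p = +-mono-Cong
      (diff-f-suc n (suc x) (subst (_< p) (cong suc (ℕ.+-suc x (suc n))) x+n<p))
      (neg-mono-Cong (diff-f-suc n x (ℕ.≤-<-trans (ℕ.+-monoʳ-≤ (suc x) (ℕ.n≤1+n (suc n))) x+n<p)))

    diff-f-zero : ∀ n → suc n < p → Cong p (diff (suc n) f 0) (-1ℤ ^ n)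
    diff-f-zero zero 1<p = begin
      f 1 - f 0 ≈⟨ +-mono-Cong (f≈1 0 1<p) (neg-mono-Cong f0≈0) ⟩
      1ℤ - 0ℤ   ≡⟨⟩
      1ℤ        ∎
      where
      f0≈0 : Cong p (f 0) 0ℤ
      -- The exponent must be seen to be positive, since 0⁰ is 1.
      f0≈0 with p ∸ 1 | ℕ.m<n⇒0<n∸m 1<p
      ... | suc _ | _ = Cong-refl
    diff-f-zero (suc n) n<p = begin
      diff (suc n) f 1 - diff (suc n) f 0
        ≈⟨ +-mono-Cong (diff-f-suc n 0 n<p) (neg-mono-Cong (diff-f-zero n (ℕ.<-trans (ℕ.n<1+n (suc n)) n<p))) ⟩
      0ℤ - -1ℤ ^ n
        ≡⟨ lemma (-1ℤ ^ n) ⟩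
      -1ℤ ^ suc n ∎
      where
      lemma : ∀ x → 0ℤ - x ≡ -1ℤ * x
      lemma = solve-∀

    go : ∀ q → q ≡ p → 1 < q → Cong p (+ ((p ∸ 1) !)) -1ℤ
    go (suc zero) _ (s≤s ())
    go (suc (suc n)) q≡p _ = begin
      + ((p ∸ 1) !)         ≡⟨ diff-pow (p ∸ 1) 0 ⟨
      diff (p ∸ 1) f 0      ≡⟨ cong (λ q → diff (q ∸ 1) f 0) q≡p ⟨
      diff (suc n) f 0      ≈⟨ diff-f-zero n (subst (suc n <_) q≡p ℕ.≤-refl) ⟩
      -- Here p = n + 2, so the sign (-1)^(p-2) equals (-1)^p.
      -1ℤ ^ n               ≡⟨ lemma (-1ℤ ^ n) ⟨
      -1ℤ ^ suc (suc n)     ≡⟨ cong (-1ℤ ^_) q≡p ⟩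
      -1ℤ ^ p               ≈⟨ -1^p ⟩
      -1ℤ                   ∎
      where
      lemma : ∀ x → -1ℤ * (-1ℤ * x) ≡ x
      lemma = solve-∀

  -- Coefficient form of (1 + X)^(p+n) ≡ (1 + X^p)(1 + X)^n: below degree `p` the factor 1 + X^p has
  -- no effect. The case n = 0 is `p∣C`.
  C-shift-< : ∀ n k → k < p → Cong p (+ ((p ℕ.+ n) C k)) (+ (n C k))
  C-shift-< n       zero    k<p = Cong-refl
  C-shift-< zero    (suc k) k<p rewrite ℕ.+-identityʳ p = ∣ℕ⇒Cong-0 (p∣C pr (suc k) (s≤s z≤n) k<p)
  C-shift-< (suc n) (suc k) k<p rewrite ℕ.+-suc p n = begin
    + (suc (p ℕ.+ n) C suc k)
      ≡⟨ pos-C-pascal (p ℕ.+ n) k ⟩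
    + ((p ℕ.+ n) C k) + + ((p ℕ.+ n) C suc k)
      ≈⟨ +-mono-Cong (C-shift-< n k (ℕ.<-trans (ℕ.n<1+n k) k<p)) (C-shift-< n (suc k) k<p) ⟩
    + (n C k) + + (n C suc k)
      ≡⟨ pos-C-pascal n k ⟨
    + (suc n C suc k) ∎

  -- The same product in degree p + k, where X^p contributes a second coefficient.
  C-shift-+ : ∀ n k → Cong p (+ ((p ℕ.+ n) C (p ℕ.+ k))) (+ (n C (p ℕ.+ k)) + + (n C k))
  C-shift-+ zero zero = Cong-reflexive (cong +_ (trans
    (trans (cong (λ n → n C n) (ℕ.+-identityʳ p)) (nCn≡1 p))
    (cong (ℕ._+ 1) (sym (k>n⇒nCk≡0 (ℕ.<-≤-trans (ℕ.<-trans (s≤s z≤n) 1<p) (ℕ.m≤m+n p 0)))))))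
  C-shift-+ zero (suc k) = Cong-reflexive (cong +_ (trans
    (k>n⇒nCk≡0 (ℕ.+-monoʳ-< p (s≤s z≤n)))
    (cong (ℕ._+ 0) (sym (k>n⇒nCk≡0 {k = p ℕ.+ suc k} (ℕ.<-≤-trans (s≤s z≤n) (ℕ.m≤n+m (suc k) p)))))))
  -- Pascal's rule in degree `p` also reaches degree p - 1, which `C-shift-<` covers.
  C-shift-+ (suc n) zero = go p refl
    where
    go : ∀ q → q ≡ p → Cong p (+ ((p ℕ.+ suc n) C (p ℕ.+ 0))) (+ (suc n C (p ℕ.+ 0)) + 1ℤ)
    go zero    q≡p = contradiction (sym q≡p) (ℕ.≢-nonZero⁻¹ p)
    go (suc h) q≡p = begin
      + ((p ℕ.+ suc n) C (p ℕ.+ 0))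
        ≡⟨ cong₂ (λ a b → + (a C b)) (ℕ.+-suc p n) p+0≡1+h ⟩
      + (suc (p ℕ.+ n) C suc h)
        ≡⟨ pos-C-pascal (p ℕ.+ n) h ⟩
      + ((p ℕ.+ n) C h) + + ((p ℕ.+ n) C suc h)
        ≡⟨ cong (λ k → + ((p ℕ.+ n) C h) + + ((p ℕ.+ n) C k)) p+0≡1+h ⟨
      + ((p ℕ.+ n) C h) + + ((p ℕ.+ n) C (p ℕ.+ 0))
        ≈⟨ +-mono-Cong (C-shift-< n h (subst (h <_) q≡p ℕ.≤-refl)) (C-shift-+ n 0) ⟩
      + (n C h) + (+ (n C (p ℕ.+ 0)) + 1ℤ)
        ≡⟨ ℤ.+-assoc (+ (n C h)) (+ (n C (p ℕ.+ 0))) 1ℤ ⟨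
      + (n C h) + + (n C (p ℕ.+ 0)) + 1ℤ
        ≡⟨ cong (λ k → + (n C h) + + (n C k) + 1ℤ) p+0≡1+h ⟩
      + (n C h) + + (n C suc h) + 1ℤ
        ≡⟨ cong (_+ 1ℤ) (pos-C-pascal n h) ⟨
      + (suc n C suc h) + 1ℤ
        ≡⟨ cong (λ k → + (suc n C k) + 1ℤ) p+0≡1+h ⟨
      + (suc n C (p ℕ.+ 0)) + 1ℤ ∎
      where
      p+0≡1+h : p ℕ.+ 0 ≡ suc h
      p+0≡1+h = trans (ℕ.+-identityʳ p) (sym q≡p)
  C-shift-+ (suc n) (suc k) rewrite ℕ.+-suc p n | ℕ.+-suc p k = begin
    + (suc (p ℕ.+ n) C suc (p ℕ.+ k))
      ≡⟨ pos-C-pascal (p ℕ.+ n) (p ℕ.+ k) ⟩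
    + ((p ℕ.+ n) C (p ℕ.+ k)) + + ((p ℕ.+ n) C suc (p ℕ.+ k))
      ≡⟨ cong (λ j → + ((p ℕ.+ n) C (p ℕ.+ k)) + + ((p ℕ.+ n) C j)) (ℕ.+-suc p k) ⟨
    + ((p ℕ.+ n) C (p ℕ.+ k)) + + ((p ℕ.+ n) C (p ℕ.+ suc k))
      ≈⟨ +-mono-Cong (C-shift-+ n k) (C-shift-+ n (suc k)) ⟩
    + (n C (p ℕ.+ k)) + + (n C k) + (+ (n C (p ℕ.+ suc k)) + + (n C suc k))
      ≡⟨ lemma (+ (n C (p ℕ.+ k))) (+ (n C k)) (+ (n C (p ℕ.+ suc k))) (+ (n C suc k)) ⟩
    + (n C (p ℕ.+ k)) + + (n C (p ℕ.+ suc k)) + (+ (n C k) + + (n C suc k))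
      ≡⟨ cong (λ j → + (n C (p ℕ.+ k)) + + (n C j) + (+ (n C k) + + (n C suc k))) (ℕ.+-suc p k) ⟩
    + (n C (p ℕ.+ k)) + + (n C suc (p ℕ.+ k)) + (+ (n C k) + + (n C suc k))
      ≡⟨ cong₂ _+_ (pos-C-pascal n (p ℕ.+ k)) (pos-C-pascal n k) ⟨
    + (suc n C suc (p ℕ.+ k)) + + (suc n C suc k) ∎
    where
    lemma : ∀ a b c d → a + b + (c + d) ≡ a + c + (b + d)
    lemma = solve-∀

  -- One `p` is removed from the row at a time; `C-shift-+` then acts as Pascal's rule on the
  -- quotients `a` and `c`.
  lucas : ∀ a c {b d} → b < p → d < p →
    Cong p (+ ((b ℕ.+ a ℕ.* p) C (d ℕ.+ c ℕ.* p))) (+ (a C c) * + (b C d))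
  lucas zero zero {b} {d} b<p d<p rewrite ℕ.+-identityʳ b | ℕ.+-identityʳ d =
    Cong-reflexive (sym (ℤ.*-identityˡ (+ (b C d))))
  lucas zero (suc c) {b} {d} b<p d<p rewrite ℕ.+-identityʳ b =
    Cong-reflexive (cong +_ (k>n⇒nCk≡0 (ℕ.<-≤-trans b<p
      (ℕ.≤-trans (ℕ.m≤m+n p (c ℕ.* p)) (ℕ.m≤n+m (p ℕ.+ c ℕ.* p) d)))))
  lucas (suc a) zero {b} {d} b<p d<p = begin
    + ((b ℕ.+ (p ℕ.+ a ℕ.* p)) C (d ℕ.+ 0))
      ≡⟨ cong₂ (λ m n → + (m C n)) (lemma b p (a ℕ.* p)) (ℕ.+-identityʳ d) ⟩
    + ((p ℕ.+ (b ℕ.+ a ℕ.* p)) C d)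
      ≈⟨ C-shift-< (b ℕ.+ a ℕ.* p) d d<p ⟩
    + ((b ℕ.+ a ℕ.* p) C d)
      ≡⟨ cong (λ n → + ((b ℕ.+ a ℕ.* p) C n)) (ℕ.+-identityʳ d) ⟨
    + ((b ℕ.+ a ℕ.* p) C (d ℕ.+ 0))
      ≈⟨ lucas a zero b<p d<p ⟩
    1ℤ * + (b C d) ∎
    where
    lemma : ∀ x y z → x ℕ.+ (y ℕ.+ z) ≡ y ℕ.+ (x ℕ.+ z)
    lemma = ℕR.solve-∀
  lucas (suc a) (suc c) {b} {d} b<p d<p = begin
    + ((b ℕ.+ (p ℕ.+ a ℕ.* p)) C (d ℕ.+ (p ℕ.+ c ℕ.* p)))
      ≡⟨ cong₂ (λ m n → + (m C n)) (lemma b p (a ℕ.* p)) (lemma d p (c ℕ.* p)) ⟩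
    + ((p ℕ.+ (b ℕ.+ a ℕ.* p)) C (p ℕ.+ (d ℕ.+ c ℕ.* p)))
      ≈⟨ C-shift-+ (b ℕ.+ a ℕ.* p) (d ℕ.+ c ℕ.* p) ⟩
    + ((b ℕ.+ a ℕ.* p) C (p ℕ.+ (d ℕ.+ c ℕ.* p))) + + ((b ℕ.+ a ℕ.* p) C (d ℕ.+ c ℕ.* p))
      ≡⟨ cong (λ n → + ((b ℕ.+ a ℕ.* p) C n) + + ((b ℕ.+ a ℕ.* p) C (d ℕ.+ c ℕ.* p))) (lemma d p (c ℕ.* p)) ⟨
    + ((b ℕ.+ a ℕ.* p) C (d ℕ.+ suc c ℕ.* p)) + + ((b ℕ.+ a ℕ.* p) C (d ℕ.+ c ℕ.* p))
      ≈⟨ +-mono-Cong (lucas a (suc c) b<p d<p) (lucas a c b<p d<p) ⟩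
    + (a C suc c) * + (b C d) + + (a C c) * + (b C d)
      ≡⟨ ℤ.*-distribʳ-+ (+ (b C d)) (+ (a C suc c)) (+ (a C c)) ⟨
    (+ (a C suc c) + + (a C c)) * + (b C d)
      ≡⟨ cong (_* + (b C d)) (trans (ℤ.+-comm (+ (a C suc c)) (+ (a C c))) (sym (pos-C-pascal a c))) ⟩
    + (suc a C suc c) * + (b C d) ∎
    where
    lemma : ∀ x y z → x ℕ.+ (y ℕ.+ z) ≡ y ℕ.+ (x ℕ.+ z)
    lemma = ℕR.solve-∀

-- Sums modulo p

-- The factor that a last base-p digit contributes modulo p; the value at 1 is (p - 1)! by Wilson's
-- theorem.
weight : ℕ → ℤ
weight 0             = 1ℤ
weight 1             = -1ℤ
weight (suc (suc _)) = 0ℤ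

∑weight : ∀ n → ∑< (suc (suc n)) weight ≡ 0ℤ
∑weight n = trans (sym (ℤ.+-assoc 1ℤ -1ℤ (∑< n (λ _ → 0ℤ)))) (trans (ℤ.+-identityˡ (∑< n (λ _ → 0ℤ))) (∑<-0 n))

-- With n = p - 1 the right side is `p` plus an excess below `r`, which exhibits the carry.
next-multiple : ∀ n r .{{_ : NonZero r}} → suc (n ℕ./ r) ℕ.* r ≡ r ∸ suc (n ℕ.% r) ℕ.+ suc n
next-multiple n r = begin
  r ℕ.+ q ℕ.* r                      ≡⟨ cong (ℕ._+ q ℕ.* r) (ℕ.m∸n+n≡m (ℕ.m%n<n n r)) ⟨
  s ℕ.+ suc (n ℕ.% r) ℕ.+ q ℕ.* r    ≡⟨ ℕ.+-assoc s (suc (n ℕ.% r)) (q ℕ.* r) ⟩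
  s ℕ.+ suc (n ℕ.% r ℕ.+ q ℕ.* r)    ≡⟨ cong (λ m → s ℕ.+ suc m) (ℕ.m≡m%n+[m/n]*n n r) ⟨
  s ℕ.+ suc n                        ∎
  where
  open ≡-Reasoning
  q = n ℕ./ r
  s = r ∸ suc (n ℕ.% r)

module _ {p : ℕ} (pr : Prime p) where

  private instance
    nonTrivial = prime⇒nonTrivial pr
    nonZero    = prime⇒nonZero pr

  open SetoidReasoning (Cong-setoid p)

  private
    a : ℕ → ℤ
    a k = + uniformMultinomial (p ∸ 1) k

    -- One factor of the product of binomials, split by Lucas' theorem once the last digit `b` and
    -- the quotient `c` of the row are known.
    C-* : ∀ {j k b d} c → (suc j ℕ.* (d ℕ.+ k ℕ.* p)) ≡ b ℕ.+ c ℕ.* p → b < p → d < p →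
      Cong p (+ uniformMultinomial (suc j) (d ℕ.+ k ℕ.* p))
             (+ (c C k) * + (b C d) * + uniformMultinomial j (d ℕ.+ k ℕ.* p))
    C-* {j} {k} {b} {d} c eq b<p d<p = begin
      + uniformMultinomial (suc j) n
        ≡⟨ cong +_ (uniformMultinomial-suc j n) ⟩
      + (((suc j ℕ.* n) C n) ℕ.* uniformMultinomial j n)
        ≡⟨ ℤ.pos-* ((suc j ℕ.* n) C n) (uniformMultinomial j n) ⟩
      + ((suc j ℕ.* n) C n) * + uniformMultinomial j n
        ≡⟨ cong (λ m → + (m C n) * + uniformMultinomial j n) eq ⟩
      + ((b ℕ.+ c ℕ.* p) C n) * + uniformMultinomial j n
        ≈⟨ *-mono-Cong (lucas pr c k b<p d<p) Cong-refl ⟩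
      + (c C k) * + (b C d) * + uniformMultinomial j n ∎
      where
      n = d ℕ.+ k ℕ.* p

    C-*-uniformMultinomial : ∀ j k x y →
      + ((suc j ℕ.* k) C k) * x * (y * + uniformMultinomial j k) ≡ x * y * + uniformMultinomial (suc j) k
    C-*-uniformMultinomial j k x y = trans (lemma (+ ((suc j ℕ.* k) C k)) x y (+ uniformMultinomial j k))
      (cong (x * y *_) (trans (sym (ℤ.pos-* ((suc j ℕ.* k) C k) (uniformMultinomial j k)))
        (cong +_ (sym (uniformMultinomial-suc j k)))))
      where
      lemma : ∀ c x y u → c * x * (y * u) ≡ x * y * (c * u)
      lemma = solve-∀

  uniformMultinomial-digit0 : ∀ j k → Cong p (+ uniformMultinomial j (k ℕ.* p)) (+ uniformMultinomial j k)
  uniformMultinomial-digit0 zero    k = Cong-refl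
  uniformMultinomial-digit0 (suc j) k = begin
    + uniformMultinomial (suc j) (k ℕ.* p)
      ≈⟨ C-* {j} {k} {0} {0} (suc j ℕ.* k) (sym (ℕ.*-assoc (suc j) k p)) 0<p 0<p ⟩
    + ((suc j ℕ.* k) C k) * 1ℤ * + uniformMultinomial j (k ℕ.* p)
      ≈⟨ *-monoʳ-Cong (+ ((suc j ℕ.* k) C k) * 1ℤ) (uniformMultinomial-digit0 j k) ⟩
    + ((suc j ℕ.* k) C k) * 1ℤ * + uniformMultinomial j k
      ≡⟨ cong (+ ((suc j ℕ.* k) C k) * 1ℤ *_) (ℤ.*-identityˡ _) ⟨
    + ((suc j ℕ.* k) C k) * 1ℤ * (1ℤ * + uniformMultinomial j k)
      ≡⟨ C-*-uniformMultinomial j k 1ℤ 1ℤ ⟩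
    1ℤ * + uniformMultinomial (suc j) k
      ≡⟨ ℤ.*-identityˡ _ ⟩
    + uniformMultinomial (suc j) k ∎
    where
    0<p = ℕ.<-trans (s≤s z≤n) (1<p pr)

  -- While suc j < p, the last digit of (suc j)(1 + kp) is suc j, so Lucas' theorem yields C(suc j,
  -- 1) = suc j; these factors accumulate to the factorial.
  uniformMultinomial-digit1 : ∀ j k → j < p →
    Cong p (+ uniformMultinomial j (suc (k ℕ.* p))) (+ (j !) * + uniformMultinomial j k)
  uniformMultinomial-digit1 zero    k _   = Cong-refl
  uniformMultinomial-digit1 (suc j) k j<p = begin
    + uniformMultinomial (suc j) (suc (k ℕ.* p))
      ≈⟨ C-* {j} {k} {suc j} {1} (suc j ℕ.* k) (lemma j k p) j<p (1<p pr) ⟩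
    + ((suc j ℕ.* k) C k) * + (suc j C 1) * + uniformMultinomial j (suc (k ℕ.* p))
      ≈⟨ *-monoʳ-Cong (+ ((suc j ℕ.* k) C k) * + (suc j C 1))
           (uniformMultinomial-digit1 j k (ℕ.<-trans (ℕ.n<1+n j) j<p)) ⟩
    + ((suc j ℕ.* k) C k) * + (suc j C 1) * (+ (j !) * + uniformMultinomial j k)
      ≡⟨ C-*-uniformMultinomial j k (+ (suc j C 1)) (+ (j !)) ⟩
    + (suc j C 1) * + (j !) * + uniformMultinomial (suc j) k
      ≡⟨ cong (_* + uniformMultinomial (suc j) k) (trans (cong (λ n → + n * + (j !)) (nC1≡n (suc j)))
           (sym (ℤ.pos-* (suc j) (j !)))) ⟩
    + (suc j !) * + uniformMultinomial (suc j) k ∎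
    where
    lemma : ∀ j k p → suc j ℕ.* (1 ℕ.+ k ℕ.* p) ≡ suc j ℕ.+ suc j ℕ.* k ℕ.* p
    lemma = ℕR.solve-∀

  -- With j = ⌊(p - 1) / r⌋ the multiple (j + 1) r is p + s with s < r, a carry in base p.
  ∣uniformMultinomial-digit≥2 : ∀ r k → 1 < r → r < p → p ∣ uniformMultinomial (p ∸ 1) (r ℕ.+ k ℕ.* p)
  ∣uniformMultinomial-digit≥2 r@(suc _) k 1<r r<p =
    ∣C⇒∣uniformMultinomial (p ∸ 1) j n (ℕ.m/n<m (p ∸ 1) r 1<r) (Cong-0⇒∣ℕ (begin
      + ((suc j ℕ.* n) C n)
        ≡⟨ cong (λ m → + (m C n)) eq ⟩
      + ((s ℕ.+ suc (suc j ℕ.* k) ℕ.* p) C n)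
        ≈⟨ lucas pr (suc (suc j ℕ.* k)) k (ℕ.<-trans s<r r<p) r<p ⟩
      + (suc (suc j ℕ.* k) C k) * + (s C r)
        ≡⟨ cong (λ m → + (suc (suc j ℕ.* k) C k) * + m) (k>n⇒nCk≡0 s<r) ⟩
      + (suc (suc j ℕ.* k) C k) * 0ℤ
        ≡⟨ ℤ.*-zeroʳ (+ (suc (suc j ℕ.* k) C k)) ⟩
      0ℤ ∎))
    where
    instance
      p-1≢0 : NonZero (p ∸ 1)
      p-1≢0 = ℕ.>-nonZero (ℕ.m<n⇒0<n∸m (1<p pr))
    n = r ℕ.+ k ℕ.* p
    j = (p ∸ 1) ℕ./ r
    t = (p ∸ 1) ℕ.% r
    s = r ∸ suc t
    t<r : t < r
    t<r = ℕ.m%n<n (p ∸ 1) r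
    s<r : s < r
    s<r = ℕ.∸-monoʳ-< {o = 0} (s≤s z≤n) t<r
    [1+j]r≡s+p : suc j ℕ.* r ≡ s ℕ.+ p
    [1+j]r≡s+p = trans (next-multiple (p ∸ 1) r) (cong (s ℕ.+_) (ℕ.suc-pred p))
    eq : suc j ℕ.* n ≡ s ℕ.+ suc (suc j ℕ.* k) ℕ.* p
    eq = trans (ℕ.*-distribˡ-+ (suc j) r (k ℕ.* p))
      (trans (cong₂ ℕ._+_ [1+j]r≡s+p (sym (ℕ.*-assoc (suc j) k p)))
        (ℕ.+-assoc s p (suc j ℕ.* k ℕ.* p)))

  term-digit : ∀ r k → r < p → Cong p (a (r ℕ.+ k ℕ.* p)) (weight r * a k)
  term-digit 0 k _ = Cong-trans (uniformMultinomial-digit0 (p ∸ 1) k) (Cong-reflexive (sym (ℤ.*-identityˡ (a k))))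
  term-digit 1 k _ = Cong-trans (uniformMultinomial-digit1 (p ∸ 1) k (ℕ.∸-monoʳ-< {o = 0} (s≤s z≤n) (ℕ.<⇒≤ (1<p pr))))
    (*-mono-Cong (wilson pr) Cong-refl)
  term-digit r@(suc (suc _)) k r<p = ∣ℕ⇒Cong-0 (∣uniformMultinomial-digit≥2 r k (s≤s (s≤s z≤n)) r<p)

  ∑-block : ∀ r k → r ≤ p → Cong p (∑< r (λ i → a (k ℕ.* p ℕ.+ i))) (∑< r weight * a k)
  ∑-block r k r≤p = begin
    ∑< r (λ i → a (k ℕ.* p ℕ.+ i))
      ≈⟨ ∑<-mono-Cong r (λ i i<r → Cong-trans (Cong-reflexive (cong a (ℕ.+-comm (k ℕ.* p) i)))
           (Cong-trans (term-digit i k (ℕ.<-≤-trans i<r r≤p)) (Cong-reflexive (ℤ.*-comm (weight i) (a k))))) ⟩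
    ∑< r (λ i → a k * weight i)
      ≡⟨ ∑<-* r (a k) weight ⟩
    a k * ∑< r weight
      ≡⟨ ℤ.*-comm (a k) (∑< r weight) ⟩
    ∑< r weight * a k ∎

  ∑-*p : ∀ k → Cong p (∑< (k ℕ.* p) a) 0ℤ
  ∑-*p zero    = Cong-refl
  ∑-*p (suc k) = begin
    ∑< (p ℕ.+ k ℕ.* p) a
      ≡⟨ cong (λ n → ∑< n a) (ℕ.+-comm p (k ℕ.* p)) ⟩
    ∑< (k ℕ.* p ℕ.+ p) a
      ≡⟨ ∑<-split (k ℕ.* p) p a ⟩
    ∑< (k ℕ.* p) a + ∑< p (λ i → a (k ℕ.* p ℕ.+ i))
      ≈⟨ +-mono-Cong (∑-*p k) (∑-block p k ℕ.≤-refl) ⟩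
    0ℤ + ∑< p weight * a k
      ≡⟨ cong (λ x → 0ℤ + x * a k) (∑weight-p p (1<p pr)) ⟩
    0ℤ ∎
    where
    ∑weight-p : ∀ n → 1 < n → ∑< n weight ≡ 0ℤ
    ∑weight-p (suc zero)    (s≤s ())
    ∑weight-p (suc (suc n)) _ = ∑weight n

  ∑-digit : ∀ r k → r < p → Cong p (∑< (r ℕ.+ k ℕ.* p) a) (∑< r weight * a k)
  ∑-digit r k r<p = begin
    ∑< (r ℕ.+ k ℕ.* p) a
      ≡⟨ cong (λ n → ∑< n a) (ℕ.+-comm r (k ℕ.* p)) ⟩
    ∑< (k ℕ.* p ℕ.+ r) a
      ≡⟨ ∑<-split (k ℕ.* p) r a ⟩
    ∑< (k ℕ.* p) a + ∑< r (λ i → a (k ℕ.* p ℕ.+ i))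
      ≈⟨ +-mono-Cong (∑-*p k) (∑-block r k (ℕ.<⇒≤ r<p)) ⟩
    0ℤ + ∑< r weight * a k
      ≡⟨ ℤ.+-identityˡ _ ⟩
    ∑< r weight * a k ∎

  term-digit>1 : ∀ (ds : List (Fin p)) → Any (1 <_) (map toℕ ds) → Cong p (a (fromDigits ds)) 0ℤ
  term-digit>1 (d ∷ ds) (here 1<d) = ∣ℕ⇒Cong-0 (∣uniformMultinomial-digit≥2 (toℕ d) (fromDigits ds) 1<d (toℕ<n d))
  term-digit>1 (d ∷ ds) (there ds>1) = begin
    a (fromDigits (d ∷ ds))                ≈⟨ term-digit (toℕ d) (fromDigits ds) (toℕ<n d) ⟩
    weight (toℕ d) * a (fromDigits ds)     ≈⟨ *-monoʳ-Cong (weight (toℕ d)) (term-digit>1 ds ds>1) ⟩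
    weight (toℕ d) * 0ℤ                    ≡⟨ ℤ.*-zeroʳ (weight (toℕ d)) ⟩
    0ℤ                                     ∎

  term-digits≤1 : ∀ (ds : List (Fin p)) → ¬ Any (1 <_) (map toℕ ds) →
    Cong p (a (fromDigits ds)) (-1ℤ ^ List.sum (map toℕ ds))
  term-digits≤1 []       _ = Cong-reflexive (cong +_ (uniformMultinomial-zero (p ∸ 1)))
  term-digits≤1 (d ∷ ds) ¬ds>1 = begin
    a (fromDigits (d ∷ ds))                  ≈⟨ term-digit (toℕ d) (fromDigits ds) (toℕ<n d) ⟩
    weight (toℕ d) * a (fromDigits ds)       ≈⟨ *-monoʳ-Cong (weight (toℕ d)) (term-digits≤1 ds (¬ds>1 ∘ there)) ⟩
    weight (toℕ d) * -1ℤ ^ List.sum (map toℕ ds) ≡⟨ weight≤1 (toℕ d) (¬ds>1 ∘ here) ⟩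
    -1ℤ ^ (toℕ d ℕ.+ List.sum (map toℕ ds))  ∎
    where
    weight≤1 : ∀ r {s} → ¬ 1 < r → weight r * -1ℤ ^ s ≡ -1ℤ ^ (r ℕ.+ s)
    weight≤1 0             _   = ℤ.*-identityˡ _
    weight≤1 1             _   = refl
    weight≤1 (suc (suc _)) ¬1< = contradiction (s≤s (s≤s z≤n)) ¬1<

  -- The partial sum of weights is 0 when the last digit is 0 or at least 2. If it is 1 then n ≡ 1,
  -- so a digit above 1 lies further up and annihilates the remaining term. The bound 1 ≤ n excludes
  -- the empty list.
  ∑-vanishes : ∀ (ds : List (Fin p)) → 1 ≤ fromDigits ds →
    (¬ (+ fromDigits ds ≡ 1ℤ [mod p ]) ⊎ Any (1 <_) (map toℕ ds)) →
    Cong p (∑< (fromDigits ds) a) 0ℤ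
  ∑-vanishes (d ∷ ds) 1≤n cond = Cong-trans (∑-digit (toℕ d) (fromDigits ds) (toℕ<n d)) (go (toℕ d) cond)
    where
    n′ = fromDigits ds
    go : ∀ r → (¬ (+ (r ℕ.+ n′ ℕ.* p) ≡ 1ℤ [mod p ]) ⊎ Any (1 <_) (r ∷ map toℕ ds)) →
      Cong p (∑< r weight * a n′) 0ℤ
    go 0 _ = Cong-refl
    go 1 (inj₁ n≢1) = contradiction (Cong.difference (+-mono-Cong (Cong-refl {x = 1ℤ}) (∣ℕ⇒Cong-0 (ℕ∣.n∣m*n n′)))) n≢1
    go 1 (inj₂ (here (s≤s ())))
    go 1 (inj₂ (there ds>1)) = *-monoʳ-Cong 1ℤ (term-digit>1 ds ds>1)
    go (suc (suc r)) _ = Cong-reflexive (cong (_* a n′) (∑weight r))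

  -- The negated condition leaves 1 as the only last digit: 0 would make `p` divide n, and 2 or more
  -- is a large digit. The `∸ 1` in the exponent removes this digit 1 from the digit sum.
  ∑-nonvanishing : ∀ (ds : List (Fin p)) → 1 ≤ fromDigits ds →
    ¬ (¬ (+ fromDigits ds ≡ 1ℤ [mod p ]) ⊎ Any (1 <_) (map toℕ ds)) →
    Cong p (∑< (fromDigits ds) a) (-1ℤ ^ (List.sum (map toℕ ds) ∸ 1))
  ∑-nonvanishing (d ∷ ds) 1≤n ¬cond = Cong-trans (∑-digit (toℕ d) (fromDigits ds) (toℕ<n d)) (go (toℕ d) ¬cond)
    where
    n′ = fromDigits ds
    go : ∀ r → ¬ (¬ (+ (r ℕ.+ n′ ℕ.* p) ≡ 1ℤ [mod p ]) ⊎ Any (1 <_) (r ∷ map toℕ ds)) →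
      Cong p (∑< r weight * a n′) (-1ℤ ^ (r ℕ.+ List.sum (map toℕ ds) ∸ 1))
    go 0 ¬cond = contradiction (inj₁ λ n≡1 → ∤1 pr (Cong-0⇒∣ℕ (begin
      1ℤ               ≈⟨ congruent n≡1 ⟨
      + (n′ ℕ.* p)     ≈⟨ ∣ℕ⇒Cong-0 (ℕ∣.n∣m*n n′) ⟩
      0ℤ               ∎))) ¬cond
    go 1 ¬cond = Cong-trans (Cong-reflexive (ℤ.*-identityˡ (a n′))) (term-digits≤1 ds (¬cond ∘ inj₂ ∘ there))
    go (suc (suc r)) ¬cond = contradiction (inj₂ (here (s≤s (s≤s z≤n)))) ¬cond

  ∑-Cong-0 : Cong p (∑< p a) 0ℤ
  ∑-Cong-0 = subst (λ n → Cong p (∑< n a) 0ℤ) (ℕ.*-identityˡ p) (∑-*p 1)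

∑-Cong-1 : ∀ {d} m → NonZero d → d < suc m → Cong d (∑< (suc m) (λ k → + uniformMultinomial m k)) 1ℤ
∑-Cong-1 m d≢0 d<m = Cong-trans
  (+-mono-Cong (Cong-reflexive (cong +_ (uniformMultinomial-zero m)))
    (∑<-Cong-0 m (λ k _ → ∣ℕ⇒Cong-0 (≤⇒∣uniformMultinomial k d≢0 (ℕ.≤-pred d<m)))))
  (Cong-reflexive (ℤ.+-identityʳ 1ℤ))

∑≡0⇒prime : ∀ m → 1 < m → ∑< m (λ k → + uniformMultinomial (m ∸ 1) k) ≡ 0ℤ [mod m ] → Prime m
∑≡0⇒prime (suc m) 1<m ∑≡0 = ¬composite⇒prime {{ℕ.n>1⇒nonTrivial 1<m}} ¬composite
  where
  ¬composite : ¬ Composite (suc m)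
  ¬composite (hasNonTrivialDivisor {d} {{d>1}} d<m d∣m) = ℕ.nonTrivial⇒≢1 {{d>1}} (ℕ∣.∣1⇒≡1 (Cong-0⇒∣ℕ
    (Cong-trans (Cong-sym (∑-Cong-1 m (ℕ.nonTrivial⇒nonZero d {{d>1}}) d<m))
      (∣⇒Cong-0 (ℤ∣.∣-trans (ℤ∣.∣ᵤ⇒∣ d∣m) (Cong-0⇒∣ (congruent ∑≡0)))))))

-- Sums modulo p²

module _ {q : ℕ} (pr : Prime (3 ℕ.+ q)) where

  private
    -- This form exposes the terms k = 0, 1, 2 of the sum to computation; the prime 2 is treated
    -- separately in `∑≡bernoulli`.
    p = 3 ℕ.+ q
    h = 2 ℕ.+ q

    p²≡p*p : p ℕ.* p ≡ p ℕ.^ 2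
    p²≡p*p = cong (p ℕ.*_) (sym (ℕ.*-identityʳ p))

  open SetoidReasoning (Cong-setoid (p ℕ.^ 2))

  *-Cong-p² : ∀ {x y} → Cong p x 0ℤ → Cong p y 0ℤ → Cong (p ℕ.^ 2) (x * y) 0ℤ
  *-Cong-p² {x} {y} x≈0 y≈0 = subst (λ m → Cong m (x * y) 0ℤ) p²≡p*p (*-mono-Cong-0 x≈0 y≈0)

  p*-Cong-p² : ∀ {x y} → Cong p x y → Cong (p ℕ.^ 2) (+ p * x) (+ p * y)
  p*-Cong-p² {x} {y} x≈y = begin
    + p * x                   ≡⟨ lemma (+ p) x y ⟩
    + p * (x - y) + + p * y   ≈⟨ +-monoˡ-Cong (+ p * y)
                                   (*-Cong-p² (∣ℕ⇒Cong-0 ℕ∣.∣-refl) (∣⇒Cong-0 (Cong.difference x≈y))) ⟩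
    0ℤ + + p * y              ≡⟨ ℤ.+-identityˡ (+ p * y) ⟩
    + p * y                   ∎
    where
    lemma : ∀ p x y → p * x ≡ p * (x - y) + p * y
    lemma = solve-∀

  -- As (x - 1)(y - 1) vanishes modulo p², multiplication becomes addition of the deviations from 1.
  units-* : ∀ {x y} → Cong p x 1ℤ → Cong p y 1ℤ → Cong (p ℕ.^ 2) (x * y) (x + y - 1ℤ)
  units-* {x} {y} x≈1 y≈1 = begin
    x * y                               ≡⟨ lemma x y ⟩
    (x - 1ℤ) * (y - 1ℤ) + (x + y - 1ℤ)  ≈⟨ +-monoˡ-Cong (x + y - 1ℤ) (*-Cong-p² (x-1≈0 x≈1) (x-1≈0 y≈1)) ⟩
    0ℤ + (x + y - 1ℤ)                   ≡⟨ ℤ.+-identityˡ (x + y - 1ℤ) ⟩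
    x + y - 1ℤ                          ∎
    where
    lemma : ∀ x y → x * y ≡ (x - 1ℤ) * (y - 1ℤ) + (x + y - 1ℤ)
    lemma = solve-∀
    x-1≈0 : ∀ {x} → Cong p x 1ℤ → Cong p (x - 1ℤ) 0ℤ
    x-1≈0 x≈1 = ∣⇒Cong-0 (Cong.difference x≈1)

  unit-^ : ∀ {y} n → Cong p y 1ℤ → Cong (p ℕ.^ 2) (y ^ n) (1ℤ + + n * (y - 1ℤ))
  unit-^ {y} zero    y≈1 = Cong-refl
  unit-^ {y} (suc n) y≈1 = begin
    y * y ^ n                        ≈⟨ units-* y≈1 (Cong-trans (^-mono-Cong n y≈1) (Cong-reflexive (ℤ.^-zeroˡ n))) ⟩
    y + y ^ n - 1ℤ                   ≈⟨ +-monoˡ-Cong -1ℤ (+-mono-Cong (Cong-refl {x = y}) (unit-^ n y≈1)) ⟩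
    y + (1ℤ + + n * (y - 1ℤ)) - 1ℤ   ≡⟨ lemma y (+ n) ⟩
    1ℤ + (1ℤ + + n) * (y - 1ℤ)       ∎
    where
    lemma : ∀ y n → y + (1ℤ + n * (y - 1ℤ)) - 1ℤ ≡ 1ℤ + (1ℤ + n) * (y - 1ℤ)
    lemma = solve-∀

  -- Each factor j^(p-1) is 1 modulo p by Fermat's theorem, so `units-*` turns the product into a
  -- sum.
  factorial-^ : ∀ n → n < p →
    Cong (p ℕ.^ 2) ((+ (n !)) ^ h) (1ℤ + ∑< n (λ j → (+ suc j) ^ h) - + n)
  factorial-^ zero    _   = Cong-reflexive (ℤ.^-zeroˡ h)
  factorial-^ (suc n) n<p = begin
    (+ (suc n !)) ^ h
      ≡⟨ cong (_^ h) (ℤ.pos-* (suc n) (n !)) ⟩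
    (+ suc n * + (n !)) ^ h
      ≡⟨ ^-distribʳ-* h (+ suc n) (+ (n !)) ⟩
    v * (+ (n !)) ^ h
      ≈⟨ units-* (fermat′ pr (ℕ∣.>⇒∤ n<p)) (fermat′ pr (∤-! pr n′<p)) ⟩
    v + (+ (n !)) ^ h - 1ℤ
      ≈⟨ +-monoˡ-Cong -1ℤ (+-mono-Cong (Cong-refl {x = v}) (factorial-^ n n′<p)) ⟩
    v + (1ℤ + s - + n) - 1ℤ
      ≡⟨ lemma v s (+ n) ⟩
    1ℤ + (s + v) - (1ℤ + + n)
      ≡⟨ cong (λ x → 1ℤ + x - + suc n) (∑<-last n (λ j → (+ suc j) ^ h)) ⟨
    1ℤ + ∑< (suc n) (λ j → (+ suc j) ^ h) - + suc n ∎
    where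
    v = (+ suc n) ^ h
    s = ∑< n (λ j → (+ suc j) ^ h)
    n′<p = ℕ.<-trans (ℕ.n<1+n n) n<p
    lemma : ∀ v s n → v + (1ℤ + s - n) - 1ℤ ≡ 1ℤ + (s + v) - (1ℤ + n)
    lemma = solve-∀

  -- The other sign would give (-1)^p = 1, hence p ∣ 2 by `-1^p`.
  -1^[p-1]≡1 : -1ℤ ^ h ≡ 1ℤ
  -1^[p-1]≡1 with -1^n≡±1 h
  ... | inj₁ eq = eq
  ... | inj₂ eq = contradiction (Cong-0⇒∣ℕ p∣2) (ℕ∣.>⇒∤ (s≤s (s≤s (s≤s z≤n))))
    where
    p∣2 : Cong p (+ 2) 0ℤ
    p∣2 = +-monoˡ-Cong 1ℤ (Cong-trans (Cong-reflexive (sym (cong (-1ℤ *_) eq))) (-1^p pr))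

  -- Comparing two evaluations of ((p - 1)!) ^ (p - 1) modulo p².
  glaisher : Cong (p ℕ.^ 2) (+ (h !)) (powerSum p h - + p)
  glaisher = begin
    W
      -- With y = -W ≡ 1 modulo p by Wilson's theorem, the first two summands are the first-order
      -- expansion of y^(p-1), and p(y - 1) vanishes modulo p².
      ≡⟨ lemma₁ W (+ p) ⟩
    1ℤ + (+ p - 1ℤ) * (y - 1ℤ) - + p * (y - 1ℤ) - + 2
      ≈⟨ +-monoˡ-Cong (- + 2) (+-mono-Cong (Cong-sym (unit-^ h y≈1))
           (neg-mono-Cong (p*-Cong-p² (∣⇒Cong-0 (Cong.difference y≈1))))) ⟩
    y ^ h - + p * 0ℤ - + 2
      ≡⟨ cong (λ x → x - + p * 0ℤ - + 2) y^h≡W^h ⟩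
    W ^ h - + p * 0ℤ - + 2
      ≈⟨ +-monoˡ-Cong (- + 2) (+-monoˡ-Cong (- (+ p * 0ℤ)) (factorial-^ h ℕ.≤-refl)) ⟩
    1ℤ + s - + h - + p * 0ℤ - + 2
      ≡⟨ lemma₂ s (+ h) (+ p) ⟩
    0ℤ + s - (1ℤ + + h) ∎
    where
    W = + (h !)
    y = -1ℤ * W
    s = ∑< h (λ j → (+ suc j) ^ h)
    y≈1 : Cong p y 1ℤ
    y≈1 = *-monoʳ-Cong -1ℤ (wilson pr)
    y^h≡W^h : y ^ h ≡ W ^ h
    y^h≡W^h = trans (^-distribʳ-* h -1ℤ W) (trans (cong (_* W ^ h) -1^[p-1]≡1) (ℤ.*-identityˡ (W ^ h)))
    lemma₁ : ∀ W p → W ≡ 1ℤ + (p - 1ℤ) * (-1ℤ * W - 1ℤ) - p * (-1ℤ * W - 1ℤ) - + 2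
    lemma₁ = solve-∀
    lemma₂ : ∀ s h p → 1ℤ + s - h - p * 0ℤ - + 2 ≡ 0ℤ + s - (1ℤ + h)
    lemma₂ = solve-∀

  p∣[p+i]! : ∀ i → p ∣ (p ℕ.+ i) !
  p∣[p+i]! i = ℕ∣.∣-trans (ℕ∣.m∣m*n (h !)) (ℕ∣.m≤n⇒m!∣n! (ℕ.m≤m+n p i))

  [p+i]!-Cong : ∀ i → Cong (p ℕ.^ 2) (+ ((p ℕ.+ i) !)) (+ (p !) * + (i !))
  [p+i]!-Cong zero    = Cong-reflexive (trans (cong (λ n → + (n !)) (ℕ.+-identityʳ p)) (sym (ℤ.*-identityʳ (+ (p !)))))
  [p+i]!-Cong (suc i) = begin
    + ((p ℕ.+ suc i) !)
      ≡⟨ cong (λ n → + (n !)) (ℕ.+-suc p i) ⟩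
    + (suc (p ℕ.+ i) ℕ.* (p ℕ.+ i) !)
      ≡⟨ ℤ.pos-* (suc (p ℕ.+ i)) ((p ℕ.+ i) !) ⟩
    + suc (p ℕ.+ i) * x
      ≡⟨ cong (_* x) (trans (cong +_ (sym (ℕ.+-suc p i))) (ℤ.pos-+ p (suc i))) ⟩
    (+ p + + suc i) * x
      ≡⟨ ℤ.*-distribʳ-+ x (+ p) (+ suc i) ⟩
    + p * x + + suc i * x
      ≈⟨ +-mono-Cong (p*-Cong-p² (∣ℕ⇒Cong-0 (p∣[p+i]! i))) (*-monoʳ-Cong (+ suc i) ([p+i]!-Cong i)) ⟩
    + p * 0ℤ + + suc i * (+ (p !) * + (i !))
      ≡⟨ lemma (+ p) (+ suc i) (+ (p !)) (+ (i !)) ⟩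
    + (p !) * (+ suc i * + (i !))
      ≡⟨ cong (+ (p !) *_) (ℤ.pos-* (suc i) (i !)) ⟨
    + (p !) * + (suc i !) ∎
    where
    x = + ((p ℕ.+ i) !)
    lemma : ∀ p s a b → p * 0ℤ + s * (a * b) ≡ a * (s * b)
    lemma = solve-∀

  [p-2]!-Cong : Cong p (+ ((1 ℕ.+ q) !)) 1ℤ
  [p-2]!-Cong = Cong-trans (Cong-reflexive (lemma (+ h) x))
    (+-mono-Cong (*-mono-Cong (∣ℕ⇒Cong-0 (ℕ∣.∣-refl {p})) (Cong-refl {x = x}))
      (neg-mono-Cong (Cong-trans (Cong-reflexive (sym (ℤ.pos-* h ((1 ℕ.+ q) !)))) (wilson pr))))
    where
    x = + ((1 ℕ.+ q) !)
    lemma : ∀ h x → x ≡ (1ℤ + h) * x - h * x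
    lemma = solve-∀

  -- The term times 2^(p-1) is (2p - 2)! = (p + (p - 2))! ≡ p! (p - 2)! ≡ -p. The term is divisible
  -- by `p` and 2^(p-1) ≡ 1 modulo p, so that power can be removed modulo p².
  term-2 : Cong (p ℕ.^ 2) (+ uniformMultinomial h 2) (- + p)
  term-2 = begin
    a₂
      ≡⟨ lemma₁ a₂ 2^h ⟩
    a₂ * 2^h - a₂ * (2^h - 1ℤ)
      ≈⟨ +-mono-Cong (Cong-refl {x = a₂ * 2^h}) (neg-mono-Cong (*-Cong-p² a₂≈0 (∣⇒Cong-0 (Cong.difference 2^h≈1)))) ⟩
    a₂ * 2^h - 0ℤ
      ≡⟨ ℤ.+-identityʳ (a₂ * 2^h) ⟩
    a₂ * 2^h
      ≡⟨ a₂*2^h≡ ⟩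
    + ((p ℕ.+ (1 ℕ.+ q)) !)
      ≈⟨ [p+i]!-Cong (1 ℕ.+ q) ⟩
    + (p !) * + ((1 ℕ.+ q) !)
      ≡⟨ trans (cong (_* + ((1 ℕ.+ q) !)) (ℤ.pos-* p (h !))) (ℤ.*-assoc (+ p) (+ (h !)) (+ ((1 ℕ.+ q) !))) ⟩
    + p * (+ (h !) * + ((1 ℕ.+ q) !))
      ≈⟨ p*-Cong-p² (*-mono-Cong (wilson pr) [p-2]!-Cong) ⟩
    + p * -1ℤ
      ≡⟨ lemma₂ (+ p) ⟩
    - + p ∎
    where
    a₂ = + uniformMultinomial h 2
    2^h = (+ 2) ^ h
    a₂≈0 : Cong p a₂ 0ℤ
    a₂≈0 = ∣ℕ⇒Cong-0 (∣uniformMultinomial-digit≥2 pr 2 0 ℕ.≤-refl (s≤s (s≤s (s≤s z≤n))))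
    2^h≈1 : Cong p 2^h 1ℤ
    2^h≈1 = fermat′ pr (ℕ∣.>⇒∤ (s≤s (s≤s (s≤s z≤n))))
    h*2≡ : ∀ q → (2 ℕ.+ q) ℕ.* 2 ≡ 3 ℕ.+ q ℕ.+ (1 ℕ.+ q)
    h*2≡ = ℕR.solve-∀
    a₂*2^h≡ : a₂ * 2^h ≡ + ((p ℕ.+ (1 ℕ.+ q)) !)
    a₂*2^h≡ = trans (cong (a₂ *_) (sym (pos-^ 2 h)))
      (trans (sym (ℤ.pos-* (uniformMultinomial h 2) (2 ℕ.^ h)))
        (cong +_ (trans (uniformMultinomial-factorial h 2) (cong _! (h*2≡ q)))))
    lemma₁ : ∀ a b → a ≡ a * b - a * (b - 1ℤ)
    lemma₁ = solve-∀
    lemma₂ : ∀ p → p * -1ℤ ≡ - p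
    lemma₂ = solve-∀

  -- Since 3(p - 1) ≥ 2p, the numerator is divisible by (p!)² and hence by p², while the denominator
  -- consists of factorials of numbers below `p`.
  term-≥3 : ∀ k → 3 ℕ.+ k < p → Cong (p ℕ.^ 2) (+ uniformMultinomial h (3 ℕ.+ k)) 0ℤ
  term-≥3 k k<p = ∣ℕ⇒Cong-0 (p^e∣m*n⇒p^e∣m pr 2 (∤-^ pr h (∤-! pr k<p))
    (subst (p ℕ.^ 2 ∣_) (sym (uniformMultinomial-factorial h (3 ℕ.+ k))) p²∣))
    where
    p∣p! : p ∣ p !
    p∣p! = ℕ∣.m∣m*n (h !)
    2p≤ : p ℕ.+ p ≤ h ℕ.* (3 ℕ.+ k)
    2p≤ = ℕ.≤-trans (ℕ.≤-trans (ℕ.m≤m+n (p ℕ.+ p) q) (ℕ.≤-reflexive (lemma q)))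
      (ℕ.*-monoʳ-≤ h (ℕ.m≤m+n 3 k))
      where
      lemma : ∀ q → 3 ℕ.+ q ℕ.+ (3 ℕ.+ q) ℕ.+ q ≡ (2 ℕ.+ q) ℕ.* 3
      lemma = ℕR.solve-∀
    p²∣ : p ℕ.^ 2 ∣ (h ℕ.* (3 ℕ.+ k)) !
    p²∣ = ℕ∣.∣-trans (subst (_∣ p ! ℕ.* p !) p²≡p*p (ℕ∣.*-pres-∣ p∣p! p∣p!))
      (ℕ∣.∣-trans (divides ((p ℕ.+ p) C p) (sym (C-factorial p p))) (ℕ∣.m≤n⇒m!∣n! 2p≤))

  ∑-Cong-p² : Cong (p ℕ.^ 2) (∑< p (λ k → + uniformMultinomial h k)) (powerSum p h + 1ℤ - + 2 * + p)
  ∑-Cong-p² = begin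
    ∑< p (λ k → + uniformMultinomial h k)
      ≈⟨ +-mono-Cong (Cong-reflexive (cong +_ (uniformMultinomial-zero h)))
           (+-mono-Cong (Cong-trans (Cong-reflexive (cong +_ (uniformMultinomial-one h))) glaisher)
             (+-mono-Cong term-2 (∑<-Cong-0 q λ k k<q → term-≥3 k (ℕ.+-monoʳ-< 3 k<q)))) ⟩
    1ℤ + (powerSum p h - + p + (- + p + 0ℤ))
      ≡⟨ lemma (powerSum p h) (+ p) ⟩
    powerSum p h + 1ℤ - + 2 * + p ∎
    where
    lemma : ∀ s p → 1ℤ + (s - p + (- p + 0ℤ)) ≡ s + 1ℤ - + 2 * p
    lemma = solve-∀

-- Valuations

^-monoʳ-∣ : ∀ m {e f} → e ≤ f → m ℕ.^ e ∣ m ℕ.^ f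
^-monoʳ-∣ m {e} {f} e≤f = subst (λ n → m ℕ.^ e ∣ m ℕ.^ n) (ℕ.m+[n∸m]≡n e≤f)
  (subst (m ℕ.^ e ∣_) (sym (ℕ.^-distribˡ-+-* m e (f ∸ e))) (ℕ∣.m∣m*n (m ℕ.^ (f ∸ e))))

n<m^n : ∀ {m} n → 1 < m → n < m ℕ.^ n
n<m^n zero    _   = s≤s z≤n
n<m^n {m} (suc n) 1<m = ℕ.≤-<-trans (n<m^n n 1<m) (ℕ.^-monoʳ-< m 1<m (ℕ.n<1+n n))

p^maxExponent∣ : ∀ p n → p ℕ.^ maxExponent p n ∣ n
p^maxExponent∣ p n with argmax-sel (λ a → a) 0 (filter (λ a → p ℕ.^ a ℕ∣.∣? n) (upTo (suc n)))
-- The default 0 of `max` is also a valid exponent, since p⁰ = 1.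
... | inj₁ eq  = subst (λ e → p ℕ.^ e ∣ n) (sym eq) (ℕ∣.1∣ n)
... | inj₂ e∈ = proj₂ (∈-filter⁻ (λ a → p ℕ.^ a ℕ∣.∣? n) {xs = upTo (suc n)} e∈)

≤maxExponent : ∀ {p n} e → 1 < p → NonZero n → p ℕ.^ e ∣ n → e ≤ maxExponent p n
≤maxExponent {p} {n} e 1<p n≢0 p^e∣n =
  All.lookup (xs≤max 0 (filter (λ a → p ℕ.^ a ℕ∣.∣? n) (upTo (suc n))))
    (∈-filter⁺ (λ a → p ℕ.^ a ℕ∣.∣? n)
      (∈-upTo⁺ (ℕ.≤-trans (n<m^n e 1<p) (ℕ.m≤n⇒m≤1+n (ℕ∣.∣⇒≤ {{n≢0}} p^e∣n)))) p^e∣n)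

≤ν⇒∣ : ∀ {p} e x → [ + e ] ≤⁺ ν p x → p ℕ.^ e ∣ ℤ.∣ x ∣
≤ν⇒∣ {p} e (+ zero)      _          = (p ℕ.^ e) ℕ∣.∣0
≤ν⇒∣ {p} e x@(ℤ.+[1+ _ ]) [ ℤ.+≤+ e≤ ] = ℕ∣.∣-trans (^-monoʳ-∣ p e≤) (p^maxExponent∣ p ℤ.∣ x ∣)
≤ν⇒∣ {p} e x@(ℤ.-[1+ _ ]) [ ℤ.+≤+ e≤ ] = ℕ∣.∣-trans (^-monoʳ-∣ p e≤) (p^maxExponent∣ p ℤ.∣ x ∣)

∣⇒≤ν : ∀ {p} e x → 1 < p → p ℕ.^ e ∣ ℤ.∣ x ∣ → [ + e ] ≤⁺ ν p x
∣⇒≤ν e (+ zero)      1<p p^e∣x = [ + e ] ≤⊤⁺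
∣⇒≤ν e (ℤ.+[1+ _ ]) 1<p p^e∣x = [ ℤ.+≤+ (≤maxExponent e 1<p _ p^e∣x) ]
∣⇒≤ν e (ℤ.-[1+ _ ]) 1<p p^e∣x = [ ℤ.+≤+ (≤maxExponent e 1<p _ p^e∣x) ]

-- The integers inside the rationals

ℚ-ring : AlmostCommutativeRing 0ℓ 0ℓ
ℚ-ring = fromCommutativeRing ℚ.+-*-commutativeRing (λ x → dec⇒maybe (0ℚ ℚ.≟ x))

fromℤ-homo-+ : ∀ x y → fromℤ (x + y) ≡ fromℤ x ℚ.+ fromℤ y
fromℤ-homo-+ x y = ℚ.toℚᵘ-injective (ℚᵘ.≃-trans (*≡* (lemma x y)) (ℚᵘ.≃-sym (ℚ.toℚᵘ-homo-+ (fromℤ x) (fromℤ y))))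
  where
  lemma : ∀ x y → (x + y) * 1ℤ ≡ (x * 1ℤ + y * 1ℤ) * 1ℤ
  lemma = solve-∀

fromℤ-homo-* : ∀ x y → fromℤ (x * y) ≡ fromℤ x ℚ.* fromℤ y
fromℤ-homo-* x y = ℚ.toℚᵘ-injective (ℚᵘ.≃-trans (*≡* refl) (ℚᵘ.≃-sym (ℚ.toℚᵘ-homo-* (fromℤ x) (fromℤ y))))

fromℤ-injective : ∀ {x y} → fromℤ x ≡ fromℤ y → x ≡ y
fromℤ-injective = cong ℚ.↥_

1/n*n≡1 : ∀ n → (+ 1 ℚ./ suc n) ℚ.* fromℤ (+ suc n) ≡ 1ℚ
1/n*n≡1 n = ℚ.toℚᵘ-injective (ℚᵘ.≃-trans (ℚ.toℚᵘ-homo-* (+ 1 ℚ./ suc n) (fromℤ (+ suc n)))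
  (ℚᵘ.≃-trans (ℚᵘ.*-congʳ (ℚ.toℚᵘ-fromℚᵘ (mkℚᵘ (+ 1) n))) (*≡* (lemma (+ suc n)))))
  where
  lemma : ∀ x → 1ℤ * x * 1ℤ ≡ 1ℤ * (x * 1ℤ)
  lemma = solve-∀

-- Localisation at p

∑ℚ< : ℕ → (ℕ → ℚ) → ℚ
∑ℚ< n f = ℚSum.sum {n} (λ k → f (toℕ k))

∑ℚ<-linear : ∀ n r (x : ℕ → ℤ) (c y : ℕ → ℚ) →
  ∑ℚ< n (λ k → c k ℚ.* (fromℤ (x k) ℚ.- r ℚ.* y k)) ≡
  ∑ℚ< n (λ k → c k ℚ.* fromℤ (x k)) ℚ.- r ℚ.* ∑ℚ< n (λ k → c k ℚ.* y k)
∑ℚ<-linear zero    r x c y = lemma r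
  where
  lemma : ∀ r → 0ℚ ≡ 0ℚ ℚ.- r ℚ.* 0ℚ
  lemma = solve-∀-in ℚ-ring
∑ℚ<-linear (suc n) r x c y = trans
  (cong (ℚ._+_ (c 0 ℚ.* (fromℤ (x 0) ℚ.- r ℚ.* y 0))) (∑ℚ<-linear n r (x ∘ suc) (c ∘ suc) (y ∘ suc)))
  (lemma (c 0) (fromℤ (x 0)) r (y 0) (∑ℚ< n (λ k → c (suc k) ℚ.* fromℤ (x (suc k))))
    (∑ℚ< n (λ k → c (suc k) ℚ.* y (suc k))))
  where
  lemma : ∀ c x r y s t → c ℚ.* (x ℚ.- r ℚ.* y) ℚ.+ (s ℚ.- r ℚ.* t) ≡
    c ℚ.* x ℚ.+ s ℚ.- r ℚ.* (c ℚ.* y ℚ.+ t)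
  lemma = solve-∀-in ℚ-ring

fromℤ-∑ : ∀ n (c x : ℕ → ℤ) →
  fromℤ (∑< n (λ k → c k * x k)) ≡ ∑ℚ< n (λ k → fromℤ (c k) ℚ.* fromℤ (x k))
fromℤ-∑ zero    c x = refl
fromℤ-∑ (suc n) c x = trans (fromℤ-homo-+ (c 0 * x 0) (∑< n (λ k → c (suc k) * x (suc k))))
  (cong₂ ℚ._+_ (fromℤ-homo-* (c 0) (x 0)) (fromℤ-∑ n (c ∘ suc) (x ∘ suc)))

private
  -- Unfolding a well-founded recursion requires that the step depend only on the values of its
  -- argument.
  bernoulliStep-ext : ∀ n {B B′ : ∀ {k} → k < n → ℚ} → (∀ {k} k<n → B {k} k<n ≡ B′ k<n) →
    bernoulliStep n B ≡ bernoulliStep n B′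
  bernoulliStep-ext zero    B≗B′ = refl
  bernoulliStep-ext (suc n) B≗B′ = cong (λ s → ℚ.- ((+ 1 ℚ./ suc (suc n)) ℚ.* s))
    (ℚSum.sum-cong-≗ (λ k → cong (ℚ._*_ (fromℤ (+ (suc (suc n) C toℕ k)))) (B≗B′ (toℕ<n k))))

bernoulli-recurrence : ∀ n → fromℤ (+ suc (suc n)) ℚ.* bernoulli (suc n) ≡
  ℚ.- ∑ℚ< (suc n) (λ k → fromℤ (+ (suc (suc n) C k)) ℚ.* bernoulli k)
bernoulli-recurrence n = begin
  N ℚ.* bernoulli (suc n)       ≡⟨ cong (N ℚ.*_) unfold ⟩
  N ℚ.* (ℚ.- (1/N ℚ.* s))       ≡⟨ lemma₁ N 1/N s ⟩
  ℚ.- (1/N ℚ.* N ℚ.* s)         ≡⟨ cong (λ x → ℚ.- (x ℚ.* s)) (1/n*n≡1 (suc n)) ⟩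
  ℚ.- (1ℚ ℚ.* s)                ≡⟨ cong ℚ.-_ (ℚ.*-identityˡ s) ⟩
  ℚ.- s                         ∎
  where
  open ≡-Reasoning
  N = fromℤ (+ suc (suc n))
  1/N = + 1 ℚ./ suc (suc n)
  s = ∑ℚ< (suc n) (λ k → fromℤ (+ (suc (suc n) C k)) ℚ.* bernoulli k)
  unfold : bernoulli (suc n) ≡ ℚ.- (1/N ℚ.* s)
  unfold = FixPoint.unfold-wfRec <-wellFounded (λ _ → ℚ) bernoulliStep bernoulliStep-ext {suc n}
  lemma₁ : ∀ N M s → N ℚ.* (ℚ.- (M ℚ.* s)) ≡ ℚ.- (M ℚ.* N ℚ.* s)
  lemma₁ = solve-∀-in ℚ-ring

-- The rationals r with r / m in the localisation of ℤ at p (for p prime).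
record LocallyDivides (p : ℕ) (m : ℤ) (r : ℚ) : Set where
  constructor locallyDivides
  field
    denominator : ℕ
    quotient    : ℤ
    p∤          : ¬ p ∣ denominator
    equality    : fromℤ (+ denominator) ℚ.* r ≡ fromℤ (m * quotient)

module _ {p : ℕ} (pr : Prime p) where

  private instance
    nonTrivial = prime⇒nonTrivial pr
    nonZero    = prime⇒nonZero pr

  locallyDivides-ℤ : ∀ {m} d c x → ¬ p ∣ d → + d * x ≡ m * c → LocallyDivides p m (fromℤ x)
  locallyDivides-ℤ d c x p∤d eq = locallyDivides d c p∤d (trans (sym (fromℤ-homo-* (+ d) x)) (cong fromℤ eq))

  locallyDivides-ℤ⁻¹ : ∀ {m} x → LocallyDivides p m (fromℤ x) →
    ∃₂ λ (d : ℕ) (c : ℤ) → ¬ p ∣ d × + d * x ≡ m * c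
  locallyDivides-ℤ⁻¹ x (locallyDivides d c p∤d eq) =
    d , c , p∤d , fromℤ-injective (trans (fromℤ-homo-* (+ d) x) eq)

  locallyDivides-multiple : ∀ m c → LocallyDivides p m (fromℤ (m * c))
  locallyDivides-multiple m c = locallyDivides-ℤ 1 c (m * c) (∤1 pr) (ℤ.*-identityˡ (m * c))

  locallyDivides-0 : ∀ m → LocallyDivides p m 0ℚ
  locallyDivides-0 m = subst (λ x → LocallyDivides p m (fromℤ x)) (ℤ.*-zeroʳ m) (locallyDivides-multiple m 0ℤ)

  locallyDivides-+ : ∀ {m r s} → LocallyDivides p m r → LocallyDivides p m s → LocallyDivides p m (r ℚ.+ s)
  locallyDivides-+ {m} {r} {s} (locallyDivides d c p∤d eq) (locallyDivides d′ c′ p∤d′ eq′) =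
    locallyDivides (d ℕ.* d′) (+ d′ * c + + d * c′) (∤-* pr p∤d p∤d′) (begin
      fromℤ (+ (d ℕ.* d′)) ℚ.* (r ℚ.+ s)
        ≡⟨ cong (ℚ._* (r ℚ.+ s)) (trans (cong fromℤ (ℤ.pos-* d d′)) (fromℤ-homo-* (+ d) (+ d′))) ⟩
      D ℚ.* D′ ℚ.* (r ℚ.+ s)
        ≡⟨ lemma₁ D D′ r s ⟩
      D′ ℚ.* (D ℚ.* r) ℚ.+ D ℚ.* (D′ ℚ.* s)
        ≡⟨ cong₂ (λ x y → D′ ℚ.* x ℚ.+ D ℚ.* y) eq eq′ ⟩
      D′ ℚ.* fromℤ (m * c) ℚ.+ D ℚ.* fromℤ (m * c′)
        ≡⟨ cong₂ ℚ._+_ (fromℤ-homo-* (+ d′) (m * c)) (fromℤ-homo-* (+ d) (m * c′)) ⟨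
      fromℤ (+ d′ * (m * c)) ℚ.+ fromℤ (+ d * (m * c′))
        ≡⟨ fromℤ-homo-+ (+ d′ * (m * c)) (+ d * (m * c′)) ⟨
      fromℤ (+ d′ * (m * c) + + d * (m * c′))
        ≡⟨ cong fromℤ (lemma₂ (+ d) (+ d′) m c c′) ⟩
      fromℤ (m * (+ d′ * c + + d * c′)) ∎)
    where
    open ≡-Reasoning
    D = fromℤ (+ d)
    D′ = fromℤ (+ d′)
    lemma₁ : ∀ D D′ r s → D ℚ.* D′ ℚ.* (r ℚ.+ s) ≡ D′ ℚ.* (D ℚ.* r) ℚ.+ D ℚ.* (D′ ℚ.* s)
    lemma₁ = solve-∀-in ℚ-ring
    lemma₂ : ∀ d d′ m c c′ → d′ * (m * c) + d * (m * c′) ≡ m * (d′ * c + d * c′)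
    lemma₂ = solve-∀

  locallyDivides-* : ∀ {m r} k → LocallyDivides p m r → LocallyDivides p (k * m) (fromℤ k ℚ.* r)
  locallyDivides-* {m} {r} k (locallyDivides d c p∤d eq) = locallyDivides d c p∤d (begin
    fromℤ (+ d) ℚ.* (fromℤ k ℚ.* r)   ≡⟨ lemma (fromℤ (+ d)) (fromℤ k) r ⟩
    fromℤ k ℚ.* (fromℤ (+ d) ℚ.* r)   ≡⟨ cong (fromℤ k ℚ.*_) eq ⟩
    fromℤ k ℚ.* fromℤ (m * c)         ≡⟨ fromℤ-homo-* k (m * c) ⟨
    fromℤ (k * (m * c))               ≡⟨ cong fromℤ (ℤ.*-assoc k m c) ⟨
    fromℤ (k * m * c)                 ∎)
    where
    open ≡-Reasoning
    lemma : ∀ d k r → d ℚ.* (k ℚ.* r) ≡ k ℚ.* (d ℚ.* r)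
    lemma = solve-∀-in ℚ-ring

  locallyDivides-weaken : ∀ {m r} k → LocallyDivides p (k * m) r → LocallyDivides p m r
  locallyDivides-weaken {m} k (locallyDivides d c p∤d eq) =
    locallyDivides d (k * c) p∤d (trans eq (cong fromℤ (lemma k m c)))
    where
    lemma : ∀ k m c → k * m * c ≡ m * (k * c)
    lemma = solve-∀

  locallyDivides-scale : ∀ {m r} k → LocallyDivides p m r → LocallyDivides p m (fromℤ k ℚ.* r)
  locallyDivides-scale k = locallyDivides-weaken k ∘ locallyDivides-* k

  locallyDivides-unit : ∀ {m r} n → ¬ p ∣ n → LocallyDivides p m (fromℤ (+ n) ℚ.* r) → LocallyDivides p m r
  locallyDivides-unit {m} {r} n p∤n (locallyDivides d c p∤d eq) = locallyDivides (d ℕ.* n) c (∤-* pr p∤d p∤n)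
    (trans (cong (ℚ._* r) (trans (cong fromℤ (ℤ.pos-* d n)) (fromℤ-homo-* (+ d) (+ n))))
      (trans (ℚ.*-assoc (fromℤ (+ d)) (fromℤ (+ n)) r) eq))

  locallyDivides-cancel : ∀ {m r} n → LocallyDivides p (+ suc n * m) (fromℤ (+ suc n) ℚ.* r) → LocallyDivides p m r
  locallyDivides-cancel {m} {r} n (locallyDivides d c p∤d eq) = locallyDivides d c p∤d (begin
    D ℚ.* r                             ≡⟨ ℚ.*-identityˡ (D ℚ.* r) ⟨
    1ℚ ℚ.* (D ℚ.* r)                    ≡⟨ cong (ℚ._* (D ℚ.* r)) (1/n*n≡1 n) ⟨
    1/N ℚ.* N ℚ.* (D ℚ.* r)             ≡⟨ lemma 1/N N D r ⟩
    1/N ℚ.* (D ℚ.* (N ℚ.* r))           ≡⟨ cong (1/N ℚ.*_) eq ⟩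
    1/N ℚ.* fromℤ (+ suc n * m * c)     ≡⟨ cong (1/N ℚ.*_) (trans (cong fromℤ (ℤ.*-assoc (+ suc n) m c))
                                             (fromℤ-homo-* (+ suc n) (m * c))) ⟩
    1/N ℚ.* (N ℚ.* fromℤ (m * c))       ≡⟨ ℚ.*-assoc 1/N N (fromℤ (m * c)) ⟨
    1/N ℚ.* N ℚ.* fromℤ (m * c)         ≡⟨ cong (ℚ._* fromℤ (m * c)) (1/n*n≡1 n) ⟩
    1ℚ ℚ.* fromℤ (m * c)                ≡⟨ ℚ.*-identityˡ (fromℤ (m * c)) ⟩
    fromℤ (m * c)                       ∎)
    where
    open ≡-Reasoning
    D = fromℤ (+ d)
    N = fromℤ (+ suc n)
    1/N = + 1 ℚ./ suc n
    lemma : ∀ M N D r → M ℚ.* N ℚ.* (D ℚ.* r) ≡ M ℚ.* (D ℚ.* (N ℚ.* r))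
    lemma = solve-∀-in ℚ-ring

  locallyDivides-∑ℚ : ∀ {m} n {f} → (∀ k → k < n → LocallyDivides p m (f k)) → LocallyDivides p m (∑ℚ< n f)
  locallyDivides-∑ℚ {m} zero    _  = locallyDivides-0 m
  locallyDivides-∑ℚ {m} (suc n) ld =
    locallyDivides-+ (ld 0 (s≤s z≤n)) (locallyDivides-∑ℚ n (λ k k<n → ld (suc k) (s≤s k<n)))

  locallyDivides-∑ : ∀ {m} n {f} → (∀ k → k < n → LocallyDivides p m (fromℤ (f k))) →
    LocallyDivides p m (fromℤ (∑< n f))
  locallyDivides-∑ {m} zero    _  = locallyDivides-0 m
  locallyDivides-∑ {m} (suc n) {f} ld =
    subst (LocallyDivides p m) (sym (fromℤ-homo-+ (f 0) (∑< n (f ∘ suc))))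
      (locallyDivides-+ (ld 0 (s≤s z≤n)) (locallyDivides-∑ n (λ k k<n → ld (suc k) (s≤s k<n))))

  -- Write suc n = q p^e with `e` maximal, so that p ∤ q. As p^e divides `x`, the multiple `q` x is
  -- divisible by suc n, and `q` serves as denominator.
  ν⇒locallyDivides : ∀ n x → ν p (+ suc n) ≤⁺ ν p x → LocallyDivides p (+ suc n) (fromℤ x)
  ν⇒locallyDivides n x ν≤ with p^maxExponent∣ p (suc n)
  ... | divides q eq = locallyDivides-ℤ q c x p∤q (begin
    + q * x                       ≡⟨ cong (+ q *_) x≡ ⟩
    + q * (c * + p^e)             ≡⟨ lemma (+ q) c (+ p^e) ⟩
    + q * + p^e * c               ≡⟨ cong (_* c) (trans (sym (ℤ.pos-* q p^e)) (cong +_ (sym eq))) ⟩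
    + suc n * c                   ∎)
    where
    open ≡-Reasoning
    e = maxExponent p (suc n)
    p^e = p ℕ.^ e
    p^e∣x : + p^e ℤ∣.∣ x
    p^e∣x = ℤ∣.∣ᵤ⇒∣ (≤ν⇒∣ e x ν≤)
    c = ℤ∣._∣_.quotient p^e∣x
    x≡ : x ≡ c * + p^e
    x≡ = ℤ∣._∣_.equality p^e∣x
    p∤q : ¬ p ∣ q
    p∤q p∣q = ℕ.<-irrefl refl (≤maxExponent (suc e) (1<p pr) _
      (subst (p ℕ.^ suc e ∣_) (sym eq) (ℕ∣.*-pres-∣ p∣q (ℕ∣.∣-refl {p^e}))))
    lemma : ∀ q c e → q * (c * e) ≡ q * e * c
    lemma = solve-∀

  locallyDivides⇒ν : ∀ n x → LocallyDivides p (+ suc n) (fromℤ x) → ν p (+ suc n) ≤⁺ ν p x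
  locallyDivides⇒ν n x ld with locallyDivides-ℤ⁻¹ x ld
  ... | d , c , p∤d , eq = ∣⇒≤ν e x (1<p pr) (p^e∣m*n⇒p^e∣m pr e p∤d
    (subst (p ℕ.^ e ∣_) |n*c|≡ (ℕ∣.∣m⇒∣m*n ℤ.∣ c ∣ (p^maxExponent∣ p (suc n)))))
    where
    e = maxExponent p (suc n)
    |n*c|≡ : suc n ℕ.* ℤ.∣ c ∣ ≡ ℤ.∣ x ∣ ℕ.* d
    |n*c|≡ = trans (sym (ℤ.abs-* (+ suc n) c)) (trans (cong ℤ.∣_∣ (sym eq))
      (trans (ℤ.abs-* (+ d) x) (ℕ.*-comm d ℤ.∣ x ∣)))

  -- Clearing denominators shows that p² divides the numerator. The fraction is in lowest terms, so
  -- `p` does not divide its denominator and nothing is subtracted from the valuation.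
  locallyDivides⇒νℚ : ∀ r → LocallyDivides p ((+ p) ^ 2) r → [ + 2 ] ≤⁺ νℚ p r
  locallyDivides⇒νℚ (mkℚ n D-1 n⊥D) (locallyDivides d c p∤d eq) =
    subst (λ e → [ + 2 ] ≤⁺ ν p n ⊖⁺ e) (sym maxExponent≡0) (≤⁺-⊖0 (∣⇒≤ν 2 n (1<p pr) p²∣n))
    where
    D = suc D-1
    dn≡ : + d * n * 1ℤ ≡ (+ p) ^ 2 * c * (1ℤ * + D)
    dn≡ with ℚᵘ.≃-trans (ℚᵘ.≃-sym (ℚ.toℚᵘ-homo-* (fromℤ (+ d)) (mkℚ n D-1 n⊥D))) (ℚ.toℚᵘ-cong eq)
    ... | *≡* e = e
    dn≡′ : n * + d ≡ c * + D * + (p ℕ.^ 2)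
    dn≡′ = trans (lemma₁ n (+ d)) (trans dn≡ (trans (lemma₂ ((+ p) ^ 2) c (+ D))
      (cong (c * + D *_) (sym (pos-^ p 2)))))
      where
      lemma₁ : ∀ n d → n * d ≡ d * n * 1ℤ
      lemma₁ = solve-∀
      lemma₂ : ∀ m c D → m * c * (1ℤ * D) ≡ c * D * m
      lemma₂ = solve-∀
    p²∣n : p ℕ.^ 2 ∣ ℤ.∣ n ∣
    p²∣n = p^e∣m*n⇒p^e∣m pr 2 p∤d (subst (p ℕ.^ 2 ∣_) (ℤ.abs-* n (+ d))
      (ℤ∣.∣⇒∣ᵤ (ℤ∣.divides (c * + D) dn≡′)))
    p∤D : ¬ p ∣ D
    p∤D p∣D = ∤1 pr (subst (p ∣_) (Coprimality.recompute n⊥D (ℕ∣.∣-trans (ℕ∣.m∣m*n (p ℕ.^ 1)) p²∣n , p∣D))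
      (ℕ∣.∣-refl))
    maxExponent≡0 : maxExponent p D ≡ 0
    maxExponent≡0 with maxExponent p D | p^maxExponent∣ p D
    ... | zero  | _     = refl
    ... | suc e | p^e∣D = contradiction (ℕ∣.∣-trans (ℕ∣.m∣m*n (p ℕ.^ e)) p^e∣D) p∤D
    ≤⁺-⊖0 : ∀ {v} → [ + 2 ] ≤⁺ v → [ + 2 ] ≤⁺ v ⊖⁺ 0
    ≤⁺-⊖0 {[ a ]} [ 2≤a ] = [ subst (+ 2 ℤ.≤_) (sym (ℤ.+-identityʳ a)) 2≤a ]
    ≤⁺-⊖0 {⊤⁺}    _       = [ + 2 ] ≤⊤⁺

-- Bernoulli numbers modulo p²

[1+n]Cn≡1+n : ∀ n → suc n C n ≡ suc n
[1+n]Cn≡1+n n = trans (nCk≡nC[n∸k] (ℕ.n≤1+n n)) (trans (cong (suc n C_) (ℕ.m+n∸n≡m 1 n)) (nC1≡n (suc n)))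

-- The recurrence for power sums minus `N` times the one for Bernoulli numbers; only N^(n+2)
-- survives as inhomogeneous term. The top summand, with coefficient C(n + 2, n + 1) = n + 2, is
-- isolated on the left.
powerSum-bernoulli-recurrence : ∀ N n → let D = λ k → fromℤ (powerSum N k) ℚ.- fromℤ (+ N) ℚ.* bernoulli k in
  fromℤ (+ suc (suc n)) ℚ.* D (suc n) ≡
  fromℤ ((+ N) ^ suc (suc n)) ℚ.+ fromℤ -1ℤ ℚ.* ∑ℚ< (suc n) (λ k → fromℤ (+ (suc (suc n) C k)) ℚ.* D k)
powerSum-bernoulli-recurrence N n = begin
  M ℚ.* (S ℚ.- r ℚ.* bernoulli (suc n))
    ≡⟨ lemma₁ M S r (bernoulli (suc n)) ⟩
  M ℚ.* S ℚ.- r ℚ.* (M ℚ.* bernoulli (suc n))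
    ≡⟨ cong (λ x → M ℚ.* S ℚ.- r ℚ.* x) (bernoulli-recurrence n) ⟩
  M ℚ.* S ℚ.- r ℚ.* (ℚ.- y)
    ≡⟨ lemma₂ (M ℚ.* S) r y x ⟩
  (x ℚ.+ M ℚ.* S) ℚ.+ (ℚ.- 1ℚ) ℚ.* (x ℚ.- r ℚ.* y)
    ≡⟨ cong₂ (λ u v → u ℚ.+ (ℚ.- 1ℚ) ℚ.* v) x+MS≡ (sym (∑ℚ<-linear (suc n) r (powerSum N) (fromℤ ∘ c) bernoulli)) ⟩
  fromℤ ((+ N) ^ suc (suc n)) ℚ.+ fromℤ -1ℤ ℚ.*
    ∑ℚ< (suc n) (λ k → fromℤ (c k) ℚ.* (fromℤ (powerSum N k) ℚ.- r ℚ.* bernoulli k)) ∎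
  where
  open ≡-Reasoning
  c : ℕ → ℤ
  c k = + (suc (suc n) C k)
  M = fromℤ (+ suc (suc n))
  S = fromℤ (powerSum N (suc n))
  r = fromℤ (+ N)
  x = ∑ℚ< (suc n) (λ k → fromℤ (c k) ℚ.* fromℤ (powerSum N k))
  y = ∑ℚ< (suc n) (λ k → fromℤ (c k) ℚ.* bernoulli k)
  x+MS≡ : x ℚ.+ M ℚ.* S ≡ fromℤ ((+ N) ^ suc (suc n))
  x+MS≡ = begin
    x ℚ.+ M ℚ.* S
      ≡⟨ cong₂ ℚ._+_ (fromℤ-∑ (suc n) c (powerSum N)) (trans (fromℤ-homo-* (c (suc n)) (powerSum N (suc n)))
           (cong (λ k → fromℤ (+ k) ℚ.* S) ([1+n]Cn≡1+n (suc n)))) ⟨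
    fromℤ (∑< (suc n) (λ k → c k * powerSum N k)) ℚ.+ fromℤ (c (suc n) * powerSum N (suc n))
      ≡⟨ fromℤ-homo-+ (∑< (suc n) (λ k → c k * powerSum N k)) (c (suc n) * powerSum N (suc n)) ⟨
    fromℤ (∑< (suc n) (λ k → c k * powerSum N k) + c (suc n) * powerSum N (suc n))
      ≡⟨ cong fromℤ (∑<-last (suc n) (λ k → c k * powerSum N k)) ⟨
    fromℤ (∑< (suc (suc n)) (λ k → c k * powerSum N k))
      ≡⟨ cong fromℤ (powerSum-recurrence (suc n) N) ⟩
    fromℤ ((+ N) ^ suc (suc n)) ∎
  lemma₁ : ∀ M S r b → M ℚ.* (S ℚ.- r ℚ.* b) ≡ M ℚ.* S ℚ.- r ℚ.* (M ℚ.* b)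
  lemma₁ = solve-∀-in ℚ-ring
  lemma₂ : ∀ s r y x → s ℚ.- r ℚ.* (ℚ.- y) ≡ (x ℚ.+ s) ℚ.+ (ℚ.- 1ℚ) ℚ.* (x ℚ.- r ℚ.* y)
  lemma₂ = solve-∀-in ℚ-ring

module _ {q : ℕ} (pr : Prime (3 ℕ.+ q)) where

  private
    p = 3 ℕ.+ q

  powerSum-bernoulli : ∀ n → n < p →
    LocallyDivides p ((+ p) ^ 2) (fromℤ (powerSum p n) ℚ.- fromℤ (+ p) ℚ.* bernoulli n)
  powerSum-bernoulli = <-rec _ step
    where
    m = (+ p) ^ 2
    D : ℕ → ℚ
    D k = fromℤ (powerSum p k) ℚ.- fromℤ (+ p) ℚ.* bernoulli k
    D0≡0 : D 0 ≡ 0ℚ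
    D0≡0 = trans (cong (λ s → fromℤ s ℚ.- fromℤ (+ p) ℚ.* 1ℚ) (powerSum-0 p)) (lemma (fromℤ (+ p)))
      where
      lemma : ∀ r → r ℚ.- r ℚ.* 1ℚ ≡ 0ℚ
      lemma = solve-∀-in ℚ-ring
    step : ∀ n → (∀ {k} → k < n → k < p → LocallyDivides p m (D k)) → n < p → LocallyDivides p m (D n)
    step zero    _  _   = subst (LocallyDivides p m) (sym D0≡0) (locallyDivides-0 pr m)
    step (suc n) ih n<p with ℕ.m≤n⇒m<n∨m≡n n<p
    -- The leading coefficient n + 2 is below `p`, hence a unit in the localisation.
    ... | inj₁ 1+n<p = locallyDivides-unit pr (suc (suc n)) (ℕ∣.>⇒∤ 1+n<p)
      (subst (LocallyDivides p m) (sym (powerSum-bernoulli-recurrence p n))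
        (locallyDivides-+ pr
          (subst (λ x → LocallyDivides p m (fromℤ x)) (sym (ℤ.^-distribˡ-+-* (+ p) 2 n))
            (locallyDivides-multiple pr m ((+ p) ^ n)))
          (locallyDivides-scale pr -1ℤ (locallyDivides-∑ℚ pr (suc n) λ k k≤n →
            locallyDivides-scale pr (+ (suc (suc n) C k)) (ih k≤n (ℕ.<-trans k≤n n<p))))))
    -- The leading coefficient is now `p` itself, so the right side is shown divisible by p³ and one
    -- `p` is cancelled; p^p = p³ p^q provides enough factors.
    ... | inj₂ refl = locallyDivides-cancel pr (suc n)
      (subst (LocallyDivides p (+ p * m)) (sym (powerSum-bernoulli-recurrence p n))
        (locallyDivides-+ pr
          (subst (λ x → LocallyDivides p (+ p * m) (fromℤ x)) (sym (ℤ.^-distribˡ-+-* (+ p) 3 q))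
            (locallyDivides-multiple pr (+ p * m) ((+ p) ^ q)))
          (locallyDivides-scale pr -1ℤ (locallyDivides-∑ℚ pr (suc n) term))))
      where
      term : ∀ k → k < suc n → LocallyDivides p (+ p * m) (fromℤ (+ (p C k)) ℚ.* D k)
      -- C(p, 0) = 1 supplies no factor `p`, but D(0) is exactly 0.
      term zero    _   = subst (λ x → LocallyDivides p (+ p * m) (fromℤ 1ℤ ℚ.* x)) (sym D0≡0)
        (locallyDivides-0 pr (+ p * m))
      term (suc k) k≤n with p∣C pr (suc k) (s≤s z≤n) (ℕ.<-trans k≤n n<p)
      ... | divides c eq = subst (LocallyDivides p (+ p * m))
        (trans (sym (ℚ.*-assoc (fromℤ (+ c)) (fromℤ (+ p)) (D (suc k)))) (cong (ℚ._* D (suc k))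
          (trans (sym (fromℤ-homo-* (+ c) (+ p))) (cong fromℤ (trans (sym (ℤ.pos-* c p)) (cong +_ (sym eq)))))))
        (locallyDivides-scale pr (+ c) (locallyDivides-* pr (+ p) (ih k≤n (ℕ.<-trans k≤n n<p))))

  ∑≡bernoulli-odd : fromℤ (∑< p (λ k → + uniformMultinomial (p ∸ 1) k))
    ≡ fromℤ (+ p) ℚ.* bernoulli (p ∸ 1) ℚ.+ fromℤ (-1ℤ ^ (p ∸ 1)) ℚ.- fromℤ (+ 2 * + p) [mod p ²]
  -- The difference of the two sides is (P - b) + (S - T), and both summands are locally divisible
  -- by p².
  ∑≡bernoulli-odd = locallyDivides⇒νℚ pr _ (subst (LocallyDivides p ((+ p) ^ 2)) eq
    (locallyDivides-+ pr (powerSum-bernoulli (p ∸ 1) ℕ.≤-refl)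
      (subst (λ x → LocallyDivides p ((+ p) ^ 2) (fromℤ x)) (sym S-T≡) (locallyDivides-multiple pr ((+ p) ^ 2) c))))
    where
    S = ∑< p (λ k → + uniformMultinomial (p ∸ 1) k)
    P = powerSum p (p ∸ 1)
    T = P + 1ℤ - + 2 * + p
    b = fromℤ (+ p) ℚ.* bernoulli (p ∸ 1)
    S≡T = Cong.difference (∑-Cong-p² pr)
    c = ℤ∣._∣_.quotient S≡T
    S-T≡ : S - T ≡ (+ p) ^ 2 * c
    S-T≡ = trans (ℤ∣._∣_.equality S≡T) (trans (cong (c *_) (pos-^ p 2)) (ℤ.*-comm c ((+ p) ^ 2)))
    lemma₂ : ∀ P b d → (P ℚ.- b) ℚ.+ d ≡ d ℚ.+ P ℚ.- b
    lemma₂ = solve-∀-in ℚ-ring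
    lemma₃ : ∀ S t b → S ℚ.+ t ℚ.+ (ℚ.- 1ℚ) ℚ.- b ≡ S ℚ.- (b ℚ.+ 1ℚ ℚ.- t)
    lemma₃ = solve-∀-in ℚ-ring
    lemma₄ : ∀ P S p → S - (P + 1ℤ - + 2 * p) + P ≡ S + + 2 * p + -1ℤ
    lemma₄ = solve-∀
    P-b+[S-T] = (fromℤ P ℚ.- b) ℚ.+ fromℤ (S - T)
    eq : P-b+[S-T] ≡ fromℤ S ℚ.- (b ℚ.+ fromℤ (-1ℤ ^ (p ∸ 1)) ℚ.- fromℤ (+ 2 * + p))
    eq = begin
      P-b+[S-T]
        ≡⟨ lemma₂ (fromℤ P) b (fromℤ (S - T)) ⟩
      fromℤ (S - T) ℚ.+ fromℤ P ℚ.- b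
        ≡⟨ cong (ℚ._- b) (fromℤ-homo-+ (S - T) P) ⟨
      fromℤ (S - T + P) ℚ.- b
        ≡⟨ cong (λ x → fromℤ x ℚ.- b) (lemma₄ P S (+ p)) ⟩
      fromℤ (S + + 2 * + p + -1ℤ) ℚ.- b
        ≡⟨ cong (ℚ._- b) (trans (fromℤ-homo-+ (S + + 2 * + p) -1ℤ)
             (cong (ℚ._+ fromℤ -1ℤ) (fromℤ-homo-+ S (+ 2 * + p)))) ⟩
      fromℤ S ℚ.+ fromℤ (+ 2 * + p) ℚ.+ fromℤ -1ℤ ℚ.- b
        ≡⟨ lemma₃ (fromℤ S) (fromℤ (+ 2 * + p)) b ⟩
      fromℤ S ℚ.- (b ℚ.+ 1ℚ ℚ.- fromℤ (+ 2 * + p))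
        ≡⟨ cong (λ x → fromℤ S ℚ.- (b ℚ.+ fromℤ x ℚ.- fromℤ (+ 2 * + p))) (-1^[p-1]≡1 pr) ⟨
      fromℤ S ℚ.- (b ℚ.+ fromℤ (-1ℤ ^ (p ∸ 1)) ℚ.- fromℤ (+ 2 * + p)) ∎
      where open ≡-Reasoning

∑≡bernoulli : ∀ p → Prime p → fromℤ (∑< p (λ k → + uniformMultinomial (p ∸ 1) k))
  ≡ fromℤ (+ p) ℚ.* bernoulli (p ∸ 1) ℚ.+ fromℤ (-1ℤ ^ (p ∸ 1)) ℚ.- fromℤ (+ 2 * + p) [mod p ²]
∑≡bernoulli 0 pr = contradiction pr ¬prime[0]
∑≡bernoulli 1 pr = contradiction pr ¬prime[1]
-- The left side is 2 and the right side 2 · (-1/2) - 1 - 4 = -6; their difference 8 has valuation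
-- 3.
∑≡bernoulli 2 pr = [ ℤ.+≤+ (s≤s (s≤s z≤n)) ]
∑≡bernoulli (suc (suc (suc q))) pr = ∑≡bernoulli-odd pr

-- The binomial transform

module _ (a : ℕ → ℤ) where

  -- Summation by parts with the boundary term kept, so that induction on `N` applies; Pascal's rule
  -- merges adjacent coefficients, whose signs are opposite.
  ∑-transform-remainder : ∀ m N → ∑< N (λ k → + (m C k) * -1ℤ ^ k * a k) ≡
    ∑< N (λ i → + (suc m C suc i) * -1ℤ ^ i * ∑< (suc i) a) + + (m C N) * -1ℤ ^ N * ∑< N a
  ∑-transform-remainder m zero    = sym (ℤ.*-zeroʳ (+ (m C 0) * -1ℤ ^ 0))
  ∑-transform-remainder m (suc N) = begin
    ∑< (suc N) (λ k → + (m C k) * -1ℤ ^ k * a k)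
      ≡⟨ ∑<-last N (λ k → + (m C k) * -1ℤ ^ k * a k) ⟩
    ∑< N (λ k → + (m C k) * -1ℤ ^ k * a k) + + (m C N) * -1ℤ ^ N * a N
      ≡⟨ cong (_+ + (m C N) * -1ℤ ^ N * a N) (∑-transform-remainder m N) ⟩
    R + + (m C N) * -1ℤ ^ N * ∑< N a + + (m C N) * -1ℤ ^ N * a N
      ≡⟨ lemma R (+ (m C N)) (+ (m C suc N)) (-1ℤ ^ N) (∑< N a) (a N) ⟩
    R + (+ (m C N) + + (m C suc N)) * -1ℤ ^ N * (∑< N a + a N) + + (m C suc N) * -1ℤ ^ suc N * (∑< N a + a N)
      ≡⟨ cong₂ (λ c A → R + c * -1ℤ ^ N * A + + (m C suc N) * -1ℤ ^ suc N * A) (pos-C-pascal m N) (∑<-last N a) ⟨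
    R + + (suc m C suc N) * -1ℤ ^ N * ∑< (suc N) a + + (m C suc N) * -1ℤ ^ suc N * ∑< (suc N) a
      ≡⟨ cong (_+ + (m C suc N) * -1ℤ ^ suc N * ∑< (suc N) a)
           (∑<-last N (λ i → + (suc m C suc i) * -1ℤ ^ i * ∑< (suc i) a)) ⟨
    ∑< (suc N) (λ i → + (suc m C suc i) * -1ℤ ^ i * ∑< (suc i) a) + + (m C suc N) * -1ℤ ^ suc N * ∑< (suc N) a ∎
    where
    open ≡-Reasoning
    R = ∑< N (λ i → + (suc m C suc i) * -1ℤ ^ i * ∑< (suc i) a)
    lemma : ∀ R c d e A x → R + c * e * A + c * e * x ≡
      R + (c + d) * e * (A + x) + d * (-1ℤ * e) * (A + x)
    lemma = solve-∀

  ∑-transform : ∀ m → ∑< (suc m) (λ k → + (m C k) * -1ℤ ^ k * a k) ≡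
    ∑< (suc m) (λ i → + (suc m C suc i) * -1ℤ ^ i * ∑< (suc i) a)
  ∑-transform m = trans (∑-transform-remainder m (suc m))
    -- At N = m + 1 the boundary coefficient C(m, m + 1) is 0.
    (trans (cong (λ c → R + + c * -1ℤ ^ suc m * ∑< (suc m) a) (k>n⇒nCk≡0 {m} {suc m} ℕ.≤-refl)) (ℤ.+-identityʳ R))
    where
    R = ∑< (suc m) (λ i → + (suc m C suc i) * -1ℤ ^ i * ∑< (suc i) a)

  module _ {p : ℕ} (pr : Prime p) where

    private
      A T : ℕ → ℤ
      A n = ∑< n a
      T n = ∑< n (λ k → + ((n ∸ 1) C k) * -1ℤ ^ k * a k)

    -- Absorption exchanges the factor suc i, supplied by `x`, for suc m.
    locallyDivides-C-* : ∀ m i {x} e → LocallyDivides p (+ suc i) (fromℤ x) →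
      LocallyDivides p (+ suc m) (fromℤ (+ (suc m C suc i) * e * x))
    locallyDivides-C-* m i {x} e ld with locallyDivides-ℤ⁻¹ pr x ld
    ... | d , c , p∤d , eq = locallyDivides-ℤ pr d (+ (m C i) * (e * c)) _ p∤d (begin
      + d * (+ (suc m C suc i) * e * x)         ≡⟨ lemma₁ (+ d) (+ (suc m C suc i)) e x ⟩
      + (suc m C suc i) * e * (+ d * x)         ≡⟨ cong (+ (suc m C suc i) * e *_) eq ⟩
      + (suc m C suc i) * e * (+ suc i * c)     ≡⟨ lemma₂ (+ (suc m C suc i)) e (+ suc i) c ⟩
      + suc i * + (suc m C suc i) * (e * c)     ≡⟨ cong (_* (e * c)) (trans (sym (ℤ.pos-* (suc i) (suc m C suc i)))
                                                     (trans (cong +_ (absorption m i)) (ℤ.pos-* (suc m) (m C i)))) ⟩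
      + suc m * + (m C i) * (e * c)             ≡⟨ ℤ.*-assoc (+ suc m) (+ (m C i)) (e * c) ⟩
      + suc m * (+ (m C i) * (e * c))           ∎)
      where
      open ≡-Reasoning
      lemma₁ : ∀ d C e x → d * (C * e * x) ≡ C * e * (d * x)
      lemma₁ = solve-∀
      lemma₂ : ∀ C e i c → C * e * (i * c) ≡ i * C * (e * c)
      lemma₂ = solve-∀

    locallyDivides-transform : (∀ n → LocallyDivides p (+ suc n) (fromℤ (A (suc n)))) →
      ∀ n → LocallyDivides p (+ suc n) (fromℤ (T (suc n)))
    locallyDivides-transform ld m = subst (λ x → LocallyDivides p (+ suc m) (fromℤ x)) (sym (∑-transform m))
      (locallyDivides-∑ pr (suc m) λ i _ → locallyDivides-C-* m i (-1ℤ ^ i) (ld i))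

    -- The last summand of the transform is (-1)^m A(m + 1), and the earlier ones are covered by
    -- induction. Subtracting them and multiplying by (-1)^m recovers A(m + 1).
    locallyDivides-transform⁻¹ : (∀ n → LocallyDivides p (+ suc n) (fromℤ (T (suc n)))) →
      ∀ n → LocallyDivides p (+ suc n) (fromℤ (A (suc n)))
    locallyDivides-transform⁻¹ ld = <-rec _ step
      where
      step : ∀ m → (∀ {k} → k < m → LocallyDivides p (+ suc k) (fromℤ (A (suc k)))) →
        LocallyDivides p (+ suc m) (fromℤ (A (suc m)))
      step m ih = subst (LocallyDivides p (+ suc m)) eq
        (locallyDivides-scale pr (-1ℤ ^ m) (locallyDivides-+ pr (ld m)
          (locallyDivides-scale pr -1ℤ (locallyDivides-∑ pr m λ i i<m → locallyDivides-C-* m i (-1ℤ ^ i) (ih i<m)))))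
        where
        open ≡-Reasoning
        R = ∑< m (λ i → + (suc m C suc i) * -1ℤ ^ i * A (suc i))
        T≡ : T (suc m) ≡ R + 1ℤ * -1ℤ ^ m * A (suc m)
        T≡ = trans (∑-transform m) (trans (∑<-last m (λ i → + (suc m C suc i) * -1ℤ ^ i * A (suc i)))
          (cong (λ c → R + + c * -1ℤ ^ m * A (suc m)) (nCn≡1 (suc m))))
        -1^m*-1^m≡1 : -1ℤ ^ m * -1ℤ ^ m ≡ 1ℤ
        -1^m*-1^m≡1 with -1^n≡±1 m
        ... | inj₁ e = cong₂ _*_ e e
        ... | inj₂ e = cong₂ _*_ e e
        lemma : ∀ e R A → e * (R + 1ℤ * e * A + -1ℤ * R) ≡ e * e * A
        lemma = solve-∀
        eq : fromℤ (-1ℤ ^ m) ℚ.* (fromℤ (T (suc m)) ℚ.+ fromℤ -1ℤ ℚ.* fromℤ R) ≡ fromℤ (A (suc m))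
        eq = begin
          fromℤ (-1ℤ ^ m) ℚ.* (fromℤ (T (suc m)) ℚ.+ fromℤ -1ℤ ℚ.* fromℤ R)
            ≡⟨ cong (λ x → fromℤ (-1ℤ ^ m) ℚ.* (fromℤ (T (suc m)) ℚ.+ x)) (fromℤ-homo-* -1ℤ R) ⟨
          fromℤ (-1ℤ ^ m) ℚ.* (fromℤ (T (suc m)) ℚ.+ fromℤ (-1ℤ * R))
            ≡⟨ cong (fromℤ (-1ℤ ^ m) ℚ.*_) (fromℤ-homo-+ (T (suc m)) (-1ℤ * R)) ⟨
          fromℤ (-1ℤ ^ m) ℚ.* fromℤ (T (suc m) + -1ℤ * R)
            ≡⟨ fromℤ-homo-* (-1ℤ ^ m) (T (suc m) + -1ℤ * R) ⟨
          fromℤ (-1ℤ ^ m * (T (suc m) + -1ℤ * R))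
            ≡⟨ cong (λ t → fromℤ (-1ℤ ^ m * (t + -1ℤ * R))) T≡ ⟩
          fromℤ (-1ℤ ^ m * (R + 1ℤ * -1ℤ ^ m * A (suc m) + -1ℤ * R))
            ≡⟨ cong fromℤ (lemma (-1ℤ ^ m) R (A (suc m))) ⟩
          fromℤ (-1ℤ ^ m * -1ℤ ^ m * A (suc m))
            ≡⟨ cong (λ e → fromℤ (e * A (suc m))) -1^m*-1^m≡1 ⟩
          fromℤ (1ℤ * A (suc m))
            ≡⟨ cong fromℤ (ℤ.*-identityˡ (A (suc m))) ⟩
          fromℤ (A (suc m)) ∎

    ν-transform : (∀ n → 1 ≤ n → ν p (+ n) ≤⁺ ν p (A n)) ⇔ (∀ n → 1 ≤ n → ν p (+ n) ≤⁺ ν p (T n))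
    ν-transform = mk⇔
      (λ h → λ { (suc n) _ → locallyDivides⇒ν pr n (T (suc n)) (locallyDivides-transform
        (λ m → ν⇒locallyDivides pr m (A (suc m)) (h (suc m) (s≤s z≤n))) n) })
      (λ h → λ { (suc n) _ → locallyDivides⇒ν pr n (A (suc n)) (locallyDivides-transform⁻¹
        (λ m → ν⇒locallyDivides pr m (T (suc m)) (h (suc m) (s≤s z≤n))) n) })

prime⇒∑≡0 : ∀ {m} → Prime m → ∑< m (λ k → + uniformMultinomial (m ∸ 1) k) ≡ 0ℤ [mod m ]
prime⇒∑≡0 pr = Cong.difference (∑-Cong-0 pr)

theorem1p2 : ∀ p → (pr : Prime p) →
    ( fromℤ (∑[ k < p ] (+ uniformMultinomial (p ∸ 1) (toℕ k)))
    ≡ fromℤ (+ p) ℚ.* bernoulli (p ∸ 1) ℚ.+ fromℤ (-1ℤ ℤ.^ (p ∸ 1)) ℚ.- fromℤ (+ 2 ℤ.* + p) [mod p ²]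
    × (∀ m → 1 < m →
    Prime m ⇔ (∑[ k < m ] (+ uniformMultinomial (m ∸ 1) (toℕ k)) ≡ 0ℤ [mod m ])))
    × (∀ n → 1 ≤ n →
    ((¬ (+ n ≡ 1ℤ [mod p ]) ⊎ Any (1 <_) (digits p n {{prime⇒nonTrivial pr}})) →
    ∑[ k < n ] (+ uniformMultinomial (p ∸ 1) (toℕ k)) ≡ 0ℤ [mod p ])
    × (¬ (¬ (+ n ≡ 1ℤ [mod p ]) ⊎ Any (1 <_) (digits p n {{prime⇒nonTrivial pr}})) →
    ∑[ k < n ] (+ uniformMultinomial (p ∸ 1) (toℕ k)) ≡ -1ℤ ℤ.^ (ψ p n {{prime⇒nonTrivial pr}} ∸ 1) [mod p ]))
    × ((∀ n → 1 ≤ n →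
    ν p (+ n) ≤⁺ ν p (∑[ k < n ] (+ uniformMultinomial (p ∸ 1) (toℕ k))))
    ⇔ (∀ n → 1 ≤ n →
    ν p (+ n) ≤⁺ ν p (∑[ k < n ] (+ ((n ∸ 1) C toℕ k) ℤ.* -1ℤ ℤ.^ toℕ k ℤ.* + uniformMultinomial (p ∸ 1) (toℕ k)))))
theorem1p2 p pr =
    (∑≡bernoulli p pr , λ m 1<m → mk⇔ prime⇒∑≡0 (∑≡0⇒prime m 1<m))
  , part-ii
  , ν-transform (λ k → + uniformMultinomial (p ∸ 1) k) pr
  where
  a : ℕ → ℤ
  a k = + uniformMultinomial (p ∸ 1) k

  part-ii : ∀ n → 1 ≤ n →
    ((¬ (+ n ≡ 1ℤ [mod p ]) ⊎ Any (1 <_) (digits p n {{prime⇒nonTrivial pr}})) → ∑< n a ≡ 0ℤ [mod p ])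
    × (¬ (¬ (+ n ≡ 1ℤ [mod p ]) ⊎ Any (1 <_) (digits p n {{prime⇒nonTrivial pr}})) →
      ∑< n a ≡ -1ℤ ^ (ψ p n {{prime⇒nonTrivial pr}} ∸ 1) [mod p ])
  part-ii n 1≤n
    -- Matching on `refl` replaces n by the value of its digit list, so both claims become
    -- statements about `ds`.
    with toDigits p {fromWitness (ℕ.nonTrivial⇒n>1 p {{prime⇒nonTrivial pr}})} n
  ... | ds , refl = (λ c → Cong.difference (∑-vanishes pr ds 1≤n c))
                  , (λ c → Cong.difference (∑-nonvanishing pr ds 1≤n c))
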